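{- For $m\ge 1$ and $0 \le a\le m$, \[ \frac{(q^{a+1}, q^{m+1-a}, q^{m+2};q^{m+2})_{\infty}}{(q;q)_{\infty} (q;q^2)_{\infty}} =\sum_{N_1,\ldots, N_m\ge 0}\frac{q^{\sum_{i=1}^{m}\binom{N_i+1}{2}}}{(q;q)_{N_1}}\begin{bmatrix}N_1+\delta_{m-a,1}\\ N_2\end{bmatrix}\begin{bmatrix}N_2+\delta_{m-a,2}\\ N_3\end{bmatrix}\cdots \begin{bmatrix}N_{m-1}+\delta_{m-a,m-1}\\ N_{m}\end{bmatrix}, \] where $\delta$ is the Kronecker delta.
   Context: $(z;q)_\infty=\prod_{j\ge0}(1-zq^j)$, $(z;q)_n=\prod_{j=0}^{n-1}(1-zq^j)$, $(a_1,\ldots,a_r;q)_\infty=\prod_i(a_i;q)_\infty$; $\begin{bmatrix} N\\ M\end{bmatrix}=\frac{(q;q)_N}{(q;q)_M(q;q)_{N-M}}$ for $0\le M\le N$ and $0$ otherwise. -}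

module Defs where

open import Data.Nat as ℕ using (ℕ; zero; suc; _≤ᵇ_; _≡ᵇ_; _∸_)
open import Data.Nat.Combinatorics using (_C_)
open import Data.Integer using (ℤ; 0ℤ; 1ℤ; _+_; _*_; -_)
open import Data.Bool using (if_then_else_)
open import Data.List using (List; []; _∷_; foldr; map; concatMap; upTo)
open import Data.Vec using (Vec; []; _∷_; toList)

-- Formal power series in q with integer coefficients: coefficient sequences.
PS : Set
PS = ℕ → ℤ

sumTo : ℕ → (ℕ → ℤ) → ℤ
sumTo zero    f = f 0
sumTo (suc n) f = sumTo n f + f (suc n)

zeroPS : PS
zeroPS _ = 0ℤ

mono : ℕ → PS
mono e n = if n ≡ᵇ e then 1ℤ else 0ℤ

onePS : PS
onePS = mono 0

_⊕_ : PS → PS → PS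
(f ⊕ g) n = f n + g n

_⊗_ : PS → PS → PS
(f ⊗ g) n = sumTo n (λ i → f i * g (n ∸ i))

infixl 6 _⊕_
infixl 7 _⊗_

-- Multiplicative inverse of a power series with constant term 1:
-- b 0 = 1, b n = - sum_{i=1}^{n} f i * b (n - i).
-- invL f n = [b n, b (n-1), ..., b 0].
private
  dot : PS → ℕ → List ℤ → ℤ
  dot f k []       = 0ℤ
  dot f k (b ∷ bs) = f k * b + dot f (suc k) bs

invL : PS → ℕ → List ℤ
invL f zero    = 1ℤ ∷ []
invL f (suc n) = (- dot f 1 (invL f n)) ∷ invL f n

inv : PS → PS
inv f n with invL f n
... | []    = 0ℤ
... | b ∷ _ = b

poch : ℕ → ℕ → ℕ → PS
poch a k zero    = onePS
poch a k (suc L) = poch a k L ⊗ (onePS ⊕ (λ n → - mono (a ℕ.+ k ℕ.* L) n))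

qfac : ℕ → PS
qfac N = poch 1 1 N

gauss : ℕ → ℕ → PS
gauss N M = if M ≤ᵇ N then qfac N ⊗ inv (qfac M) ⊗ inv (qfac (N ∸ M)) else zeroPS

δ : ℕ → ℕ → ℕ
δ i j = if i ≡ᵇ j then 1 else 0

-- LHS with every infinite product truncated to its first B factors:
-- (q^{a+1}, q^{m+1-a}, q^{m+2}; q^{m+2})_B / ((q;q)_B (q;q^2)_B)
lhsTrunc : ℕ → ℕ → ℕ → PS
lhsTrunc m a B =
  poch (suc a) (m ℕ.+ 2) B ⊗ poch (suc m ∸ a) (m ℕ.+ 2) B ⊗ poch (m ℕ.+ 2) (m ℕ.+ 2) B
    ⊗ inv (poch 1 1 B) ⊗ inv (poch 1 2 B)

gaussChain : ℕ → ℕ → List ℕ → PS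
gaussChain d i (x ∷ y ∷ rest) = gauss (x ℕ.+ δ d i) y ⊗ gaussChain d (suc i) (y ∷ rest)
gaussChain d i _              = onePS

triSum : List ℕ → ℕ
triSum = foldr (λ x s → (suc x C 2) ℕ.+ s) 0

summand : ℕ → List ℕ → PS
summand d []           = zeroPS
summand d Ns@(N₁ ∷ _) = mono (triSum Ns) ⊗ inv (qfac N₁) ⊗ gaussChain d 1 Ns

box : ℕ → (m : ℕ) → List (Vec ℕ m)
box B zero    = [] ∷ []
box B (suc m) = concatMap (λ x → map (x ∷_) (box B m)) (upTo (suc B))

sumPS : List PS → PS
sumPS = foldr _⊕_ zeroPS

rhsTrunc : ℕ → ℕ → ℕ → PS
rhsTrunc m a B = sumPS (map (λ v → summand (m ∸ a) (toList v)) (box B m))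

{-# OPTIONS --safe #-}
module Submission where

-- Put E r L = (-q;q)_L / ((q)_{L-r} (q)_{L+r+1}) and (T f)(L) = Σ_y q^{y(y+1)/2} f(y) / (q)_{L-y}.
-- A q-Chu–Vandermonde sum says that T multiplies E r by q^{r(r+1)/2}.  For 0 < a < m the multisum
-- is (q)_∞ times the value at L = ∞ of T^{m-a} S T^{a+1} δ₀, where the Kronecker delta accounts for
-- (S f)(L) = (1 - q^{L+1}) f(L+1); for a = 0 and a = m no delta occurs and it is T^{m+1} δ₀.
-- The finite Jacobi triple product expands (x;Q)_{L+1} (y;Q)_L, Q = xy, over the kernel
-- 1/((Q)_{L-s} (Q)_{L+s+1}) with theta coefficients g x y s; for (x , y) = (q , 1) this expands
-- δ₀ in the E s.  On these coefficients T sends (x , y) to (x , qy) and S sends (q , y) to (y , q),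
-- so one ends with (q^{a+1} , q^{m-a+1}), up to the order of x and y, and the triple product turns
-- the theta series into the product side.
-- The coefficient of q^n is computed in ℤ[[q]]/(q^{n+1}), where all limits are attained.

open import Defs
open import Algebra.Bundles using (CommutativeRing; RawRing)
open import Algebra.Morphism.Structures using (module RingMorphisms)
open import Data.Bool as Bool using (true; false)
open import Data.Integer as ℤ using (ℤ; 0ℤ; 1ℤ)
import Data.Integer.Properties as ℤₚ
open import Data.List using (List; []; _∷_; _++_; map; concatMap; applyUpTo)
open import Data.List.Properties using (map-++; map-∘; ++-identityʳ)
import Data.Maybe as Maybe
open import Data.Nat as ℕ using (ℕ; zero; suc; _≤_; _<_; z≤n; s≤s; _∸_; _≤ᵇ_)
open import Data.Nat.Combinatorics using (_C_; nC1≡n; nCk+nC[k+1]≡[n+1]C[k+1])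
import Data.Nat.Properties as ℕₚ
open import Data.Product using (∃-syntax; _,_)
open import Data.Sum using (inj₁; inj₂)
open import Data.Unit using (tt)
open import Data.Vec using (Vec; []; _∷_; toList)
open import Function using (_∘_; id)
open import Relation.Binary.PropositionalEquality as ≡ using (_≡_; _≗_)
open import Relation.Nullary.Decidable using (dec⇒maybe)

-- In `ℤ[[q]]/(q^{n+1})` the element `q` is nilpotent: powers of `q` cannot be cancelled and
-- negative exponents have no meaning. Relations between neighbouring kernels therefore stay
-- multiplied by a power of `q`, and bilateral sums are folded to `s ≥ 0`, which is possible because
-- `1/((Q)_{L-s} (Q)_{L+s+1})` is invariant under `s ↦ -1-s`. The action of `T` and `S` is visible
-- on the theta term `(-1)^n x^{n(n+1)/2} y^{n(n-1)/2}`. The exponent `n(n-1)/2` equals `s(s+1)/2`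
-- at both folded indices `n = -s` and `n = s+1`, so the eigenvalue of `T` turns `y` into `qy`.
-- Exchanging `x` and `y` is `n ↦ -n`, which breaks up the folded pairs; `S` makes up for this by a
-- relation between `E (s-1)`, `E s` and `E (s+1)` whose factor `1 - q^{2s+1}` is the one contained
-- in `g q y s`, hence the condition `x = q`. The factors `(-q;q)_L` of `E` end as
-- `(-q;q)_∞ = 1/(q;q^2)_∞`.

module IntegerSolver {κ ℓ} (R : CommutativeRing κ ℓ) where
  open CommutativeRing R
  open import Data.Integer using (+_; -[1+_]; _⊖_)
  -- For this version of `×` the multiple `1 × 1#` reduces to `1#`, so solver constants match the
  -- `1#` of the goals by computation.
  open import Algebra.Properties.Semiring.Mult.TCOptimised semiring using (_×_; ×-homo-+; ×1-homo-*; 1+×)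
  open import Algebra.Properties.Ring ring
  open import Algebra.Properties.AbelianGroup +-abelianGroup
  open import Algebra.Solver.Ring.AlmostCommutativeRing
  open import Relation.Binary.Reasoning.Setoid setoid

  -- Normalisation has to decide equality of coefficients, so these are taken from `ℤ` and not from
  -- `R`.
  ι : ℤ → Carrier
  ι (+ n)    = n × 1#
  ι -[1+ n ] = - (suc n × 1#)

  ι-neg : ∀ z → ι (ℤ.- z) ≈ - ι z
  ι-neg (+ zero)  = sym -0#≈0#
  ι-neg (+ suc n) = refl
  ι-neg -[1+ n ]  = sym (-‿involutive (suc n × 1#))

  ι-⊖ : ∀ m n → ι (m ⊖ n) ≈ m × 1# - n × 1#
  ι-⊖ m zero = sym (trans (+-congˡ -0#≈0#) (+-identityʳ _))
  ι-⊖ zero (suc n) = sym (+-identityˡ _)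
  ι-⊖ (suc m) (suc n) = begin
    ι (suc m ⊖ suc n)                       ≡⟨ ≡.cong ι (ℤₚ.[1+m]⊖[1+n]≡m⊖n m n) ⟩
    ι (m ⊖ n)                               ≈⟨ ι-⊖ m n ⟩
    m × 1# - n × 1#                         ≈⟨ +-congʳ (sym (+-identityˡ _)) ⟩
    (0# + m × 1#) - n × 1#                  ≈⟨ +-congʳ (+-congʳ (sym (-‿inverseʳ 1#))) ⟩
    (1# - 1# + m × 1#) - n × 1#             ≈⟨ +-congʳ (+-assoc _ _ _) ⟩
    (1# + (- 1# + m × 1#)) - n × 1#         ≈⟨ +-congʳ (+-congˡ (+-comm _ _)) ⟩
    (1# + (m × 1# - 1#)) - n × 1#           ≈⟨ +-congʳ (+-assoc _ _ _) ⟨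
    (1# + m × 1# - 1#) - n × 1#             ≈⟨ +-assoc _ _ _ ⟩
    1# + m × 1# + (- 1# - n × 1#)           ≈⟨ +-congˡ (⁻¹-∙-comm _ _) ⟩
    1# + m × 1# - (1# + n × 1#)             ≈⟨ +-cong (1+× m 1#) (-‿cong (1+× n 1#)) ⟨
    suc m × 1# - suc n × 1#                 ∎

  ι-+ : ∀ y z → ι (y ℤ.+ z) ≈ ι y + ι z
  ι-+ (+ m)    (+ n)    = ×-homo-+ 1# m n
  ι-+ (+ m)    -[1+ n ] = ι-⊖ m (suc n)
  ι-+ -[1+ m ] (+ n)    = trans (ι-⊖ n (suc m)) (+-comm _ _)
  ι-+ -[1+ m ] -[1+ n ] = begin
    - (suc (suc (m ℕ.+ n)) × 1#)       ≡⟨ ≡.cong (λ k → - (suc k × 1#)) (≡.sym (ℕₚ.+-suc m n)) ⟩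
    - ((suc m ℕ.+ suc n) × 1#)         ≈⟨ -‿cong (×-homo-+ 1# (suc m) (suc n)) ⟩
    - (suc m × 1# + suc n × 1#)        ≈⟨ ⁻¹-∙-comm _ _ ⟨
    - (suc m × 1#) - suc n × 1#        ∎

  ι-*⁺ : ∀ m z → ι (+ m ℤ.* z) ≈ ι (+ m) * ι z
  ι-*⁺ m (+ n) = trans (reflexive (≡.cong ι (≡.sym (ℤₚ.pos-* m n)))) (×1-homo-* m n)
  ι-*⁺ m -[1+ n ] = begin
    ι (+ m ℤ.* -[1+ n ])         ≡⟨ ≡.cong ι (≡.sym (ℤₚ.neg-distribʳ-* (+ m) (+ suc n))) ⟩
    ι (ℤ.- (+ m ℤ.* + suc n))    ≈⟨ ι-neg (+ m ℤ.* + suc n) ⟩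
    - ι (+ m ℤ.* + suc n)        ≈⟨ -‿cong (ι-*⁺ m (+ suc n)) ⟩
    - (m × 1# * suc n × 1#)      ≈⟨ -‿distribʳ-* _ _ ⟩
    m × 1# * - (suc n × 1#)      ∎

  ι-* : ∀ y z → ι (y ℤ.* z) ≈ ι y * ι z
  ι-* (+ m)    z = ι-*⁺ m z
  ι-* -[1+ m ] z = begin
    ι (-[1+ m ] ℤ.* z)           ≡⟨ ≡.cong ι (≡.sym (ℤₚ.neg-distribˡ-* (+ suc m) z)) ⟩
    ι (ℤ.- (+ suc m ℤ.* z))      ≈⟨ ι-neg (+ suc m ℤ.* z) ⟩
    - ι (+ suc m ℤ.* z)          ≈⟨ -‿cong (ι-*⁺ (suc m) z) ⟩
    - (suc m × 1# * ι z)         ≈⟨ -‿distribˡ-* _ _ ⟩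
    - (suc m × 1#) * ι z         ∎

  morphism : ℤ.+-*-rawRing -Raw-AlmostCommutative⟶ fromCommutativeRing R
  morphism = record
    { ⟦_⟧    = ι
    ; +-homo = ι-+
    ; *-homo = ι-*
    ; -‿homo = ι-neg
    ; 0-homo = refl
    ; 1-homo = refl
    }

  open import Algebra.Solver.Ring ℤ.+-*-rawRing (fromCommutativeRing R) morphism
    (λ y z → Maybe.map (λ y≡z → reflexive (≡.cong ι y≡z)) (dec⇒maybe (y ℤ.≟ z)))
    public using (solve; _:=_; _:+_; _:*_; _:-_; :-_; con; Polynomial)

  :1 : ∀ {n} → Polynomial n
  :1 = con (+ 1)
  :0 : ∀ {n} → Polynomial n
  :0 = con (+ 0)

-- Finite sums in a commutative ring.

module FiniteSums {κ ℓ} (R : CommutativeRing κ ℓ) where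
  open CommutativeRing R
  open IntegerSolver R
  open import Relation.Binary.Reasoning.Setoid setoid

  Σ≤ : ℕ → (ℕ → Carrier) → Carrier
  Σ≤ zero    f = f 0
  Σ≤ (suc n) f = Σ≤ n f + f (suc n)

  Σ-cong≤ : ∀ n {f g} → (∀ i → i ≤ n → f i ≈ g i) → Σ≤ n f ≈ Σ≤ n g
  Σ-cong≤ zero    f≈g = f≈g 0 z≤n
  Σ-cong≤ (suc n) f≈g =
    +-cong (Σ-cong≤ n (λ i i≤n → f≈g i (ℕₚ.m≤n⇒m≤1+n i≤n))) (f≈g (suc n) ℕₚ.≤-refl)

  Σ-cong : ∀ n {f g} → (∀ i → f i ≈ g i) → Σ≤ n f ≈ Σ≤ n g
  Σ-cong n f≈g = Σ-cong≤ n (λ i _ → f≈g i)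

  Σ-distrib-+ : ∀ n f g → Σ≤ n (λ i → f i + g i) ≈ Σ≤ n f + Σ≤ n g
  Σ-distrib-+ zero    f g = refl
  Σ-distrib-+ (suc n) f g = trans (+-congʳ (Σ-distrib-+ n f g))
    (solve 4 (λ a b c d → a :+ b :+ (c :+ d) := a :+ c :+ (b :+ d)) refl _ _ _ _)

  Σ-distribˡ-* : ∀ n a f → Σ≤ n (λ i → a * f i) ≈ a * Σ≤ n f
  Σ-distribˡ-* zero    a f = refl
  Σ-distribˡ-* (suc n) a f = trans (+-congʳ (Σ-distribˡ-* n a f)) (sym (distribˡ a _ _))

  Σ-head : ∀ n f → Σ≤ (suc n) f ≈ f 0 + Σ≤ n (f ∘ suc)
  Σ-head zero    f = refl
  Σ-head (suc n) f = trans (+-congʳ (Σ-head n f)) (+-assoc _ _ _)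

  Σ-swap : ∀ m n (f : ℕ → ℕ → Carrier) → Σ≤ m (λ i → Σ≤ n (f i)) ≈ Σ≤ n (λ j → Σ≤ m (λ i → f i j))
  Σ-swap zero    n f = refl
  Σ-swap (suc m) n f = trans (+-congʳ (Σ-swap m n f)) (sym (Σ-distrib-+ n _ _))

  Σ-zero : ∀ n {f} → (∀ i → i ≤ n → f i ≈ 0#) → Σ≤ n f ≈ 0#
  Σ-zero zero    f≈0 = f≈0 0 z≤n
  Σ-zero (suc n) f≈0 =
    trans (+-cong (Σ-zero n (λ i i≤n → f≈0 i (ℕₚ.m≤n⇒m≤1+n i≤n))) (f≈0 (suc n) ℕₚ.≤-refl))
          (+-identityˡ 0#)

  Σ-truncate+ : ∀ n k {f} → (∀ i → n < i → f i ≈ 0#) → Σ≤ (k ℕ.+ n) f ≈ Σ≤ n f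
  Σ-truncate+ n zero    f≈0 = refl
  Σ-truncate+ n (suc k) f≈0 =
    trans (+-cong (Σ-truncate+ n k f≈0) (f≈0 _ (s≤s (ℕₚ.m≤n+m n k)))) (+-identityʳ _)

  Σ-truncate : ∀ {m n f} → n ≤ m → (∀ i → n < i → f i ≈ 0#) → Σ≤ m f ≈ Σ≤ n f
  Σ-truncate {m} {n} n≤m f≈0 =
    ≡.subst (λ k → Σ≤ k _ ≈ Σ≤ n _) (ℕₚ.m∸n+n≡m n≤m) (Σ-truncate+ n (m ℕ.∸ n) f≈0)

  Σ-drop : ∀ r n {f} → (∀ i → i < r → f i ≈ 0#) → Σ≤ (r ℕ.+ n) f ≈ Σ≤ n (λ j → f (r ℕ.+ j))
  Σ-drop zero    n     f≈0 = refl
  Σ-drop (suc r) n {f} f≈0 = begin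
    Σ≤ (suc (r ℕ.+ n)) f            ≈⟨ Σ-head (r ℕ.+ n) f ⟩
    f 0 + Σ≤ (r ℕ.+ n) (f ∘ suc)    ≈⟨ +-cong (f≈0 0 (s≤s z≤n)) (Σ-drop r n (λ i i<r → f≈0 (suc i) (s≤s i<r))) ⟩
    0# + Σ≤ n (λ j → f (suc r ℕ.+ j)) ≈⟨ +-identityˡ _ ⟩
    Σ≤ n (λ j → f (suc r ℕ.+ j))    ∎

-- The ring of formal power series, its truncations and inverses.

module PowerSeries where
  open import Data.Integer using (_+_; _*_; -_)
  open ≡ using (refl; sym; trans; cong; cong₂)
  open ≡.≡-Reasoning

  private
    module ℤΣ = FiniteSums ℤₚ.+-*-commutativeRing
    open IntegerSolver ℤₚ.+-*-commutativeRing

  sumTo-Σ : ∀ n f → sumTo n f ≡ ℤΣ.Σ≤ n f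
  sumTo-Σ zero    f = refl
  sumTo-Σ (suc n) f = cong (_+ f (suc n)) (sumTo-Σ n f)

  sumTo-cong : ∀ n {f g} → (∀ i → i ≤ n → f i ≡ g i) → sumTo n f ≡ sumTo n g
  sumTo-cong n {f} {g} f≡g = trans (sumTo-Σ n f) (trans (ℤΣ.Σ-cong≤ n f≡g) (sym (sumTo-Σ n g)))

  sumTo-head : ∀ n f → sumTo (suc n) f ≡ f 0 + sumTo n (f ∘ suc)
  sumTo-head n f = trans (sumTo-Σ (suc n) f) (trans (ℤΣ.Σ-head n f) (cong (f 0 +_) (sym (sumTo-Σ n (f ∘ suc)))))

  sumTo-reverse : ∀ n f → sumTo n f ≡ sumTo n (λ i → f (n ∸ i))
  sumTo-reverse zero    f = refl
  sumTo-reverse (suc n) f = begin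
    sumTo n f + f (suc n)                       ≡⟨ ℤₚ.+-comm _ (f (suc n)) ⟩
    f (suc n) + sumTo n f                       ≡⟨ cong (f (suc n) +_) (sumTo-reverse n f) ⟩
    f (suc n) + sumTo n (λ i → f (n ∸ i))       ≡⟨ sumTo-head n (λ i → f (suc n ∸ i)) ⟨
    sumTo (suc n) (λ i → f (suc n ∸ i))         ∎

  ⊗-cong≤ : ∀ n {f f′ g g′} → (∀ i → i ≤ n → f i ≡ f′ i) → (∀ i → i ≤ n → g i ≡ g′ i) → (f ⊗ g) n ≡ (f′ ⊗ g′) n
  ⊗-cong≤ n f≡ g≡ = sumTo-cong n (λ i i≤n → cong₂ _*_ (f≡ i i≤n) (g≡ (n ∸ i) (ℕₚ.m∸n≤m n i)))

  ⊗-comm : ∀ f g → f ⊗ g ≗ g ⊗ f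
  ⊗-comm f g n = trans (sumTo-reverse n _) (sumTo-cong n (λ i i≤n →
    trans (cong (λ k → f (n ∸ i) * g k) (ℕₚ.m∸[m∸n]≡n i≤n)) (ℤₚ.*-comm (f (n ∸ i)) (g i))))

  -- Removing the constant term of the left factor leaves a product one degree lower, so
  -- associativity becomes an induction on the degree without reindexing a double sum.
  ⊗-suc : ∀ f g n → (f ⊗ g) (suc n) ≡ f 0 * g (suc n) + ((f ∘ suc) ⊗ g) n
  ⊗-suc f g n = sumTo-head n (λ i → f i * g (suc n ∸ i))

  ⊗-distribʳ : ∀ h f g → (f ⊕ g) ⊗ h ≗ f ⊗ h ⊕ g ⊗ h
  ⊗-distribʳ h f g n = begin
    sumTo n (λ i → (f i + g i) * h (n ∸ i))
      ≡⟨ sumTo-cong n (λ i _ → ℤₚ.*-distribʳ-+ (h (n ∸ i)) (f i) (g i)) ⟩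
    sumTo n (λ i → f i * h (n ∸ i) + g i * h (n ∸ i))
      ≡⟨ trans (sumTo-Σ n _) (ℤΣ.Σ-distrib-+ n _ _) ⟩
    ℤΣ.Σ≤ n (λ i → f i * h (n ∸ i)) + ℤΣ.Σ≤ n (λ i → g i * h (n ∸ i))
      ≡⟨ cong₂ _+_ (sumTo-Σ n _) (sumTo-Σ n _) ⟨
    (f ⊗ h) n + (g ⊗ h) n ∎

  ⊗-scale : ∀ c f g n → ((λ i → c * f i) ⊗ g) n ≡ c * (f ⊗ g) n
  ⊗-scale c f g n = begin
    sumTo n (λ i → c * f i * g (n ∸ i))      ≡⟨ sumTo-cong n (λ i _ → ℤₚ.*-assoc c (f i) (g (n ∸ i))) ⟩
    sumTo n (λ i → c * (f i * g (n ∸ i)))    ≡⟨ trans (sumTo-Σ n _) (ℤΣ.Σ-distribˡ-* n c _) ⟩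
    c * ℤΣ.Σ≤ n (λ i → f i * g (n ∸ i))      ≡⟨ cong (c *_) (sumTo-Σ n _) ⟨
    c * (f ⊗ g) n                            ∎

  ⊗-assoc : ∀ f g h → (f ⊗ g) ⊗ h ≗ f ⊗ (g ⊗ h)
  ⊗-assoc f g h zero    = ℤₚ.*-assoc (f 0) (g 0) (h 0)
  ⊗-assoc f g h (suc n) = begin
    ((f ⊗ g) ⊗ h) (suc n)
      ≡⟨ ⊗-suc (f ⊗ g) h n ⟩
    f 0 * g 0 * h (suc n) + (((f ⊗ g) ∘ suc) ⊗ h) n
      ≡⟨ cong (f 0 * g 0 * h (suc n) +_) (⊗-cong≤ n {g = h} (λ i _ → ⊗-suc f g i) (λ _ _ → refl)) ⟩
    f 0 * g 0 * h (suc n) + (((λ i → f 0 * g (suc i)) ⊕ ((f ∘ suc) ⊗ g)) ⊗ h) n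
      ≡⟨ cong (f 0 * g 0 * h (suc n) +_) (⊗-distribʳ h (λ i → f 0 * g (suc i)) ((f ∘ suc) ⊗ g) n) ⟩
    f 0 * g 0 * h (suc n) + (((λ i → f 0 * g (suc i)) ⊗ h) n + (((f ∘ suc) ⊗ g) ⊗ h) n)
      ≡⟨ cong (f 0 * g 0 * h (suc n) +_) (cong₂ _+_ (⊗-scale (f 0) (g ∘ suc) h n) (⊗-assoc (f ∘ suc) g h n)) ⟩
    f 0 * g 0 * h (suc n) + (f 0 * ((g ∘ suc) ⊗ h) n + ((f ∘ suc) ⊗ (g ⊗ h)) n)
      ≡⟨ solve 5 (λ a b c d e → a :* b :* c :+ (a :* d :+ e) := a :* (b :* c :+ d) :+ e) refl (f 0) (g 0) (h (suc n)) _ _ ⟩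
    f 0 * (g 0 * h (suc n) + ((g ∘ suc) ⊗ h) n) + ((f ∘ suc) ⊗ (g ⊗ h)) n
      ≡⟨ cong (λ z → f 0 * z + ((f ∘ suc) ⊗ (g ⊗ h)) n) (⊗-suc g h n) ⟨
    f 0 * (g ⊗ h) (suc n) + ((f ∘ suc) ⊗ (g ⊗ h)) n
      ≡⟨ ⊗-suc f (g ⊗ h) n ⟨
    (f ⊗ (g ⊗ h)) (suc n) ∎

  ⊗-identityˡ : ∀ f → onePS ⊗ f ≗ f
  ⊗-identityˡ f zero    = ℤₚ.*-identityˡ (f 0)
  ⊗-identityˡ f (suc n) = begin
    (onePS ⊗ f) (suc n)                     ≡⟨ ⊗-suc onePS f n ⟩
    1ℤ * f (suc n) + (zeroPS ⊗ f) n         ≡⟨ cong₂ _+_ (ℤₚ.*-identityˡ (f (suc n)))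
                                                (trans (sumTo-Σ n _) (ℤΣ.Σ-zero n (λ _ _ → refl))) ⟩
    f (suc n) + 0ℤ                          ≡⟨ ℤₚ.+-identityʳ _ ⟩
    f (suc n)                               ∎

  -- ℤ[[q]]/(q^{N+1}): equality of the coefficients up to q^N.
  truncatedPS : ℕ → CommutativeRing _ _
  truncatedPS N = record
    { Carrier = PS
    ; _≈_ = λ f g → ∀ i → i ≤ N → f i ≡ g i
    ; _+_ = _⊕_
    ; _*_ = _⊗_
    ; -_ = λ f i → - f i
    ; 0# = zeroPS
    ; 1# = onePS
    ; isCommutativeRing = record
      { isRing = record
        { +-isAbelianGroup = record
          { isGroup = record
            { isMonoid = record
              { isSemigroup = record
                { isMagma = record
                  { isEquivalence = record
                    { refl  = λ _ _ → refl
                    ; sym   = λ f≈g i i≤N → sym (f≈g i i≤N)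
                    ; trans = λ f≈g g≈h i i≤N → trans (f≈g i i≤N) (g≈h i i≤N)
                    }
                  ; ∙-cong = λ f≈ g≈ i i≤N → cong₂ _+_ (f≈ i i≤N) (g≈ i i≤N)
                  }
                ; assoc = λ f g h i _ → ℤₚ.+-assoc (f i) (g i) (h i)
                }
              ; identity = (λ f i _ → ℤₚ.+-identityˡ (f i)) , (λ f i _ → ℤₚ.+-identityʳ (f i))
              }
            ; inverse = (λ f i _ → ℤₚ.+-inverseˡ (f i)) , (λ f i _ → ℤₚ.+-inverseʳ (f i))
            ; ⁻¹-cong = λ f≈ i i≤N → cong -_ (f≈ i i≤N)
            }
          ; comm = λ f g i _ → ℤₚ.+-comm (f i) (g i)
          }
        ; *-cong = λ f≈ g≈ i i≤N → ⊗-cong≤ i (λ j j≤i → f≈ j (ℕₚ.≤-trans j≤i i≤N)) (λ j j≤i → g≈ j (ℕₚ.≤-trans j≤i i≤N))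
        ; *-assoc = λ f g h i _ → ⊗-assoc f g h i
        ; *-identity = (λ f i _ → ⊗-identityˡ f i) , (λ f i _ → trans (⊗-comm f onePS i) (⊗-identityˡ f i))
        ; distrib = (λ h f g i _ → trans (⊗-comm h (f ⊕ g) i) (trans (⊗-distribʳ h f g i) (cong₂ _+_ (⊗-comm f h i) (⊗-comm g h i))))
                  , (λ h f g i _ → ⊗-distribʳ h f g i)
        }
      ; *-comm = λ f g i _ → ⊗-comm f g i
      }
    }

  rawPS : RawRing _ _
  rawPS = record { _≈_ = _≗_ ; _+_ = _⊕_ ; _*_ = _⊗_ ; -_ = λ f i → - f i ; 0# = zeroPS ; 1# = onePS }

  truncation : ∀ N → RingMorphisms.IsRingHomomorphism rawPS (CommutativeRing.rawRing (truncatedPS N)) id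
  truncation N = record
    { isSemiringHomomorphism = record
      { isNearSemiringHomomorphism = record
        { +-isMonoidHomomorphism = record
          { isMagmaHomomorphism = record
            { isRelHomomorphism = record { cong = λ f≗g i _ → f≗g i }
            ; homo = λ _ _ _ _ → refl
            }
          ; ε-homo = λ _ _ → refl
          }
        ; *-homo = λ _ _ _ _ → refl
        }
      ; 1#-homo = λ _ _ → refl
      }
    ; -‿homo = λ _ _ _ → refl
    }

  mono-suc : ∀ e → mono (suc e) ≗ mono 1 ⊗ mono e
  mono-suc e zero    = refl
  mono-suc e (suc n) = sym (begin
    (mono 1 ⊗ mono e) (suc n)                          ≡⟨ ⊗-suc (mono 1) (mono e) n ⟩
    0ℤ * mono e (suc n) + (onePS ⊗ mono e) n           ≡⟨ ℤₚ.+-identityˡ _ ⟩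
    (onePS ⊗ mono e) n                                 ≡⟨ ⊗-identityˡ (mono e) n ⟩
    mono e n                                           ∎)

  mono-vanish : ∀ {e i} → i < e → mono e i ≡ 0ℤ
  mono-vanish {suc e} {zero}  _         = refl
  mono-vanish {suc e} {suc i} (s≤s i<e) = mono-vanish i<e

  -- Defs keeps this function private; with its arguments abstracted to variables,
  -- the equation inv-dot determines it by pattern unification.
  dot′ : PS → ℕ → List ℤ → ℤ
  inv-dot : ∀ f n → inv f (suc n) ≡ - dot′ f 1 (invL f n)
  dot′ = _
  inv-dot f n with 1 | invL f n
  ... | k | bs = refl

  -- Each step down the list `invL f n`, which starts at the top coefficient, raises the offset,
  -- hence a general `k`. At `k = 1` the sum is the part of `f ⊗ inv f` that the next coefficient of
  -- the inverse has to cancel.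
  dot-invL : ∀ f k n → dot′ f k (invL f n) ≡ ((λ i → f (k ℕ.+ i)) ⊗ inv f) n
  dot-invL f k zero rewrite ℕₚ.+-identityʳ k = ℤₚ.+-identityʳ _
  dot-invL f k (suc n) = begin
    f k * inv f (suc n) + dot′ f (suc k) (invL f n)
      ≡⟨ cong₂ (λ j z → f j * inv f (suc n) + z) (sym (ℕₚ.+-identityʳ k)) (dot-invL f (suc k) n) ⟩
    f (k ℕ.+ 0) * inv f (suc n) + ((λ i → f (suc k ℕ.+ i)) ⊗ inv f) n
      ≡⟨ cong (f (k ℕ.+ 0) * inv f (suc n) +_) (⊗-cong≤ n {g = inv f} (λ i _ → cong f (sym (ℕₚ.+-suc k i))) (λ _ _ → refl)) ⟩
    f (k ℕ.+ 0) * inv f (suc n) + ((λ i → f (k ℕ.+ suc i)) ⊗ inv f) n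
      ≡⟨ ⊗-suc (λ i → f (k ℕ.+ i)) (inv f) n ⟨
    ((λ i → f (k ℕ.+ i)) ⊗ inv f) (suc n) ∎

  inv-inverseʳ : ∀ f → f 0 ≡ 1ℤ → f ⊗ inv f ≗ onePS
  inv-inverseʳ f f₀≡1 zero    = trans (ℤₚ.*-identityʳ (f 0)) f₀≡1
  inv-inverseʳ f f₀≡1 (suc n) = begin
    (f ⊗ inv f) (suc n)                                 ≡⟨ ⊗-suc f (inv f) n ⟩
    f 0 * inv f (suc n) + ((f ∘ suc) ⊗ inv f) n         ≡⟨ cong₂ (λ a b → a * b + t) f₀≡1 (trans (inv-dot f n) (cong -_ (dot-invL f 1 n))) ⟩
    1ℤ * - t + t                                        ≡⟨ cong (_+ t) (ℤₚ.*-identityˡ (- t)) ⟩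
    - t + t                                             ≡⟨ ℤₚ.+-inverseˡ t ⟩
    0ℤ                                                  ∎
    where t = ((f ∘ suc) ⊗ inv f) n

open PowerSeries

poch-constant : ∀ a k L → poch (suc a) k L 0 ≡ 1ℤ
poch-constant a k zero    = ≡.refl
poch-constant a k (suc L) = ≡.cong (ℤ._* 1ℤ) (poch-constant a k L)

triangle-suc : ∀ y → suc (suc y) C 2 ≡ suc y ℕ.+ (suc y C 2)
triangle-suc y = ≡.trans (≡.sym (nCk+nC[k+1]≡[n+1]C[k+1] (suc y) 1)) (≡.cong (ℕ._+ (suc y C 2)) (nC1≡n (suc y)))

-- q-series over an arbitrary commutative ring: Pochhammer symbols, their reciprocals, theta
-- coefficients.

module QSeries {κ ℓ} (R : CommutativeRing κ ℓ) where
  open CommutativeRing R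
  open IntegerSolver R
  open FiniteSums R
  open import Relation.Binary.Reasoning.Setoid setoid

  module Pochhammer where
    open import Algebra.Properties.Semiring.Exp semiring public
      using (_^_; ^-homo-*; ^-congˡ; ^-assocʳ)
    open import Algebra.Properties.CommutativeSemiring.Exp commutativeSemiring public using (^-distrib-*)

    pochhammer : Carrier → Carrier → ℕ → Carrier
    pochhammer x Q zero    = 1#
    pochhammer x Q (suc n) = pochhammer x Q n * (1# - x * Q ^ n)

  open Pochhammer

  module Truncated (p : ℕ → Carrier) where
    -- pm L r is p (L - r), read as 0 when r > L.
    pm : ℕ → ℕ → Carrier
    pm L       zero    = p L
    pm zero    (suc r) = 0#
    pm (suc L) (suc r) = pm L r

    pm-zero : ∀ {L r} → L < r → pm L r ≈ 0#
    pm-zero {zero}  {suc r} _         = refl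
    pm-zero {suc L} {suc r} (s≤s L<r) = pm-zero L<r

    pm-+ : ∀ r n j → pm (r ℕ.+ n) (r ℕ.+ j) ≡ pm n j
    pm-+ zero    n j = ≡.refl
    pm-+ (suc r) n j = pm-+ r n j

    pm-∸ : ∀ {L r} → r ≤ L → pm L r ≡ p (L ℕ.∸ r)
    pm-∸ z≤n       = ≡.refl
    pm-∸ (s≤s r≤L) = pm-∸ r≤L

    h : ℕ → ℕ → Carrier
    h n s = pm n s * p (suc (n ℕ.+ s))

    h-zero : ∀ {n s} → n < s → h n s ≈ 0#
    h-zero n<s = trans (*-congʳ (pm-zero n<s)) (zeroˡ _)

  module Reciprocals
    (Q : Carrier) (p : ℕ → Carrier) (p-inverse : ∀ n → pochhammer Q Q n * p n ≈ 1#) where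

    open Truncated p public

    p-zero : p 0 ≈ 1#
    p-zero = trans (sym (*-identityˡ (p 0))) (p-inverse 0)

    p-suc : ∀ n → p (suc n) * (1# - Q ^ suc n) ≈ p n
    p-suc n = begin
      p (suc n) * F                               ≈⟨ *-identityʳ _ ⟨
      p (suc n) * F * 1#                          ≈⟨ *-congˡ (p-inverse n) ⟨
      p (suc n) * F * (pochhammer Q Q n * p n)    ≈⟨ solve 4 (λ a b c d → a :* b :* (c :* d) := c :* b :* a :* d) refl _ _ _ _ ⟩
      pochhammer Q Q (suc n) * p (suc n) * p n    ≈⟨ *-congʳ (p-inverse (suc n)) ⟩
      1# * p n                                    ≈⟨ *-identityˡ _ ⟩
      p n                                         ∎
      where F = 1# - Q ^ suc n

    -- This is `p-suc` for `L - r`, multiplied by `Q ^ r` so that `1 - Q^{L-r}` becomes `Q^r - Q^L`;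
    -- the form also covers `r ≥ L`, where both sides vanish.
    pm-suc : ∀ L r → Q ^ r * pm L (suc r) ≈ pm L r * (Q ^ r - Q ^ L)
    pm-suc zero zero = solve 1 (λ a → :1 :* :0 := a :* (:1 :- :1)) refl (p 0)
    pm-suc (suc L) zero = trans (*-identityˡ (p L)) (sym (p-suc L))
    pm-suc zero (suc r) = solve 2 (λ a b → a :* :0 := :0 :* b) refl _ _
    pm-suc (suc L) (suc r) = begin
      Q * Q ^ r * pm L (suc r)            ≈⟨ *-assoc _ _ _ ⟩
      Q * (Q ^ r * pm L (suc r))          ≈⟨ *-congˡ (pm-suc L r) ⟩
      Q * (pm L r * (Q ^ r - Q ^ L))      ≈⟨ solve 4 (λ q a b c → q :* (a :* (b :- c)) := a :* (q :* b :- q :* c)) refl _ _ _ _ ⟩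
      pm L r * (Q * Q ^ r - Q * Q ^ L)    ∎

  module Theta where

    -- Σ_{s ≥ 0} g x y s is the theta series Σ_{n ∈ ℤ} (-1)^n x^n (xy)^{n(n-1)/2},
    -- where the terms n = -s (u) and n = s + 1 (v) are put together.
    u v g : Carrier → Carrier → ℕ → Carrier
    u x y zero    = 1#
    u x y (suc s) = - (u x y s * (x * y) ^ s * y)
    v x y zero    = x
    v x y (suc s) = - (v x y s * (x * y) ^ suc s * x)
    g x y s = u x y s - v x y s

  -- The finite Jacobi triple product.

  module JacobiTripleProduct
    (x y : Carrier) (p : ℕ → Carrier)
    (p-inverse : ∀ n → pochhammer (x * y) (x * y) n * p n ≈ 1#) where
    private Q = x * y
    open Reciprocals Q p p-inverse
    open Theta using () renaming (u to u′; v to v′; g to g′)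

    private
      u = u′ x y
      v = v′ x y
      g = g′ x y

    private
      -- The quotient of `g (suc s)` by `Q ^ s`. The power split off here pays for the one on the
      -- left of `pm-suc`.
      ĝ : ℕ → Carrier
      ĝ s = v s * Q * x - u s * y

      g-suc : ∀ s → g (suc s) ≈ Q ^ s * ĝ s
      g-suc s = solve 6 (λ u v Q X x y → (:- (u :* X :* y)) :- (:- (v :* (Q :* X) :* x)) := X :* (v :* Q :* x :- u :* y))
        refl (u s) (v s) Q (Q ^ s) x y

      -- In the recurrence `D-h`, `h n s` receives `γ n s` from index `s - 1` and `Q ^ n * ĝ s` from
      -- index `s + 1`. The clause at `0` is the contribution of index `0` to `h n (-1)`, folded
      -- back to `h n 0`.
      γ : ℕ → ℕ → Carrier
      γ n zero    = g 0 * (Q * Q ^ n)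
      γ n (suc s) = g s * (Q * Q * Q ^ n * Q ^ s)

      -- `(1 - Q^{2n+2}) (1 - Q^{2n+3})`, the quotient of `(Q)_{2n+3}` by `(Q)_{2n+1}`.
      D : ℕ → Carrier
      D n = (1# - Q * Q * Q ^ n * Q ^ n) * (1# - Q * Q * Q * Q ^ n * Q ^ n)

      -- The two neighbours give the cross term of `(1 - x Q^{n+1}) (1 - y Q^n)`; the remaining part
      -- `1 + Q^{2n+2}`, where `xy = Q` is used, is the diagonal coefficient in `D-h`.
      γ+ĝ : ∀ n s → γ n s + Q ^ n * ĝ s ≈ - (Q * Q ^ n * x + Q ^ n * y) * g s
      γ+ĝ n zero = solve 3 (λ x y Y →
          (:1 :- x) :* (x :* y :* Y) :+ Y :* (x :* (x :* y) :* x :- :1 :* y) :=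
          (:- (x :* y :* Y :* x :+ Y :* y)) :* (:1 :- x)) refl x y (Q ^ n)
      γ+ĝ n (suc s) = solve 6 (λ x y Y X u v → let Q = x :* y in
          (u :- v) :* (Q :* Q :* Y :* X) :+ Y :* ((:- (v :* (Q :* X) :* x)) :* Q :* x :- (:- (u :* X :* y)) :* y) :=
          (:- (Q :* Y :* x :+ Y :* y)) :* (:- (u :* X :* y) :- :- (v :* (Q :* X) :* x)))
        refl x y (Q ^ n) (Q ^ s) (u s) (v s)

      D-h-zero : ∀ n → g 0 * (D n * h (suc n) 0) ≈
        (1# + Q * Q * Q ^ n * Q ^ n) * (g 0 * h n 0) + γ n 0 * h n 0 + γ n 1 * h n 1
      D-h-zero n rewrite ℕₚ.+-suc n 0 | ℕₚ.+-identityʳ n = begin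
        g 0 * (D n * (p (suc n) * b))
          ≈⟨ solve 5 (λ g Q Y a b →
               g :* ((:1 :- Q :* Q :* Y :* Y) :* (:1 :- Q :* Q :* Q :* Y :* Y) :* (a :* b)) :=
               (:1 :+ Q :* Q :* Y :* Y) :* (g :* (a :* (:1 :- Q :* Y) :* (b :* (:1 :- Q :* (Q :* Y)))))
               :+ g :* (Q :* Y) :* (a :* (:1 :- Q :* Y) :* (b :* (:1 :- Q :* (Q :* Y))))
               :+ g :* (Q :* Q :* Y :* :1) :* (a :* (:1 :- Q :* Y) :* (:1 :- Y) :* b)) refl (g 0) Q (Q ^ n) (p (suc n)) b ⟩
        (1# + Q * Q * Q ^ n * Q ^ n) * (g 0 * (p (suc n) * (1# - Q ^ suc n) * (b * (1# - Q ^ suc (suc n)))))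
          + γ n 0 * (p (suc n) * (1# - Q ^ suc n) * (b * (1# - Q ^ suc (suc n))))
          + γ n 1 * (p (suc n) * (1# - Q ^ suc n) * (1# - Q ^ n) * b)
          ≈⟨ +-cong (+-cong (*-congˡ (*-congˡ h0)) (*-congˡ h0)) (*-congˡ (*-congʳ h1)) ⟩
        (1# + Q * Q * Q ^ n * Q ^ n) * (g 0 * (p n * p (suc n))) + γ n 0 * (p n * p (suc n)) + γ n 1 * (pm n 1 * b) ∎
        where
        b = p (suc (suc n))
        h0 = *-cong (p-suc n) (p-suc (suc n))
        h1 = trans (*-congʳ (p-suc n)) (trans (sym (pm-suc n 0)) (*-identityˡ _))

      D-h-suc : ∀ n s → g (suc s) * (D n * h (suc n) (suc s)) ≈
        (1# + Q * Q * Q ^ n * Q ^ n) * (g (suc s) * h n (suc s)) + Q ^ n * ĝ s * h n s + γ n (suc (suc s)) * h n (suc (suc s))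
      D-h-suc n s rewrite ℕₚ.+-suc n (suc s) | ℕₚ.+-suc n s = begin
        g (suc s) * (D n * (a * b))
          ≈⟨ *-congʳ (g-suc s) ⟩
        X * ĝ s * (D n * (a * b))
          ≈⟨ solve 6 (λ g Q X Y a b →
               X :* g :* ((:1 :- Q :* Q :* Y :* Y) :* (:1 :- Q :* Q :* Q :* Y :* Y) :* (a :* b)) :=
               (:1 :+ Q :* Q :* Y :* Y) :* (g :* ((a :* (X :- Y)) :* (b :* (:1 :- Q :* (Q :* (Q :* (Y :* X)))))))
               :+ Y :* g :* (a :* (b :* (:1 :- Q :* (Q :* (Q :* (Y :* X)))) :* (:1 :- Q :* (Q :* (Y :* X)))))
               :+ g :* (Q :* Q :* Y) :* (a :* (X :- Y) :* (Q :* X :- Y) :* b)) refl (ĝ s) Q X Y a b ⟩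
        c * (ĝ s * ((a * (X - Y)) * (b * (1# - Q * (Q * (Q * (Y * X)))))))
          + Y * ĝ s * (a * (b * (1# - Q * (Q * (Q * (Y * X)))) * (1# - Q * (Q * (Y * X)))))
          + ĝ s * (Q * Q * Y) * (a * (X - Y) * (Q * X - Y) * b)
          ≈⟨ +-cong (+-cong (*-congˡ (*-congˡ (*-cong (sym (pm-suc n s)) b1))) (*-congˡ (*-congˡ b2)))
                    (*-congˡ (*-congʳ a2)) ⟩
        c * (ĝ s * (X * pm n (suc s) * p (suc (suc (n ℕ.+ s)))))
          + Y * ĝ s * (a * p (suc (n ℕ.+ s)))
          + ĝ s * (Q * Q * Y) * (X * (Q * X * pm n (suc (suc s))) * b)
          ≈⟨ +-cong (+-congʳ (*-congˡ (solve 4 (λ g X a b → g :* (X :* a :* b) := X :* g :* (a :* b)) refl _ _ _ _)))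
               (solve 6 (λ g Q X Y a b → g :* (Q :* Q :* Y) :* (X :* (Q :* X :* a) :* b) := X :* g :* (Q :* Q :* Y :* (Q :* X)) :* (a :* b))
                  refl (ĝ s) Q X Y (pm n (suc (suc s))) b) ⟩
        c * (X * ĝ s * (pm n (suc s) * p (suc (suc (n ℕ.+ s)))))
          + Y * ĝ s * (a * p (suc (n ℕ.+ s)))
          + X * ĝ s * (Q * Q * Y * (Q * X)) * (pm n (suc (suc s)) * b)
          ≈⟨ +-cong (+-congʳ (*-congˡ (*-congʳ (g-suc s)))) (*-congʳ (*-congʳ (g-suc s))) ⟨
        c * (g (suc s) * (pm n (suc s) * p (suc (suc (n ℕ.+ s)))))
          + Y * ĝ s * (a * p (suc (n ℕ.+ s)))
          + γ n (suc (suc s)) * (pm n (suc (suc s)) * b) ∎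
        where
        X = Q ^ s
        Y = Q ^ n
        c = 1# + Q * Q * Q ^ n * Q ^ n
        a = pm n s
        b = p (suc (suc (suc (n ℕ.+ s))))
        b1 : b * (1# - Q * (Q * (Q * (Y * X)))) ≈ p (suc (suc (n ℕ.+ s)))
        b1 = trans (*-congˡ (+-congˡ (-‿cong (*-congˡ (*-congˡ (*-congˡ (sym (^-homo-* Q n s)))))))) (p-suc _)
        b2 : b * (1# - Q * (Q * (Q * (Y * X)))) * (1# - Q * (Q * (Y * X))) ≈ p (suc (n ℕ.+ s))
        b2 = trans (*-cong b1 (+-congˡ (-‿cong (*-congˡ (*-congˡ (sym (^-homo-* Q n s))))))) (p-suc _)
        a2 : a * (X - Y) * (Q * X - Y) ≈ X * (Q * X * pm n (suc (suc s)))
        a2 = begin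
          a * (X - Y) * (Q * X - Y)              ≈⟨ *-congʳ (pm-suc n s) ⟨
          X * pm n (suc s) * (Q * X - Y)         ≈⟨ *-assoc _ _ _ ⟩
          X * (pm n (suc s) * (Q * X - Y))       ≈⟨ *-congˡ (pm-suc n (suc s)) ⟨
          X * (Q * X * pm n (suc (suc s)))       ∎

      prev : ℕ → ℕ → Carrier
      prev n zero    = γ n 0 * h n 0
      prev n (suc s) = Q ^ n * ĝ s * h n s

      -- Unfolded to integers `s` and freed of `g s`, this is `D n h(n+1,s) = (1 + Q^{2n+2}) h(n,s)
      -- + Q^{n+1-s} h(n,s-1) + Q^{n+s+2} h(n,s+1)`. The exponent `n+1-s` may be negative; `ĝ`
      -- absorbs it.
      D-h : ∀ n s → g s * (D n * h (suc n) s) ≈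
        (1# + Q * Q * Q ^ n * Q ^ n) * (g s * h n s) + prev n s + γ n (suc s) * h n (suc s)
      D-h n zero    = D-h-zero n
      D-h n (suc s) = D-h-suc n s

      D-Σ : ∀ n → D n * Σ≤ (suc n) (λ s → g s * h (suc n) s) ≈
        (1# - x * Q ^ suc n) * (1# - y * Q ^ n) * Σ≤ n (λ s → g s * h n s)
      D-Σ n = begin
        D n * Σ≤ (suc n) (λ s → g s * h (suc n) s)
          ≈⟨ Σ-distribˡ-* (suc n) (D n) _ ⟨
        Σ≤ (suc n) (λ s → D n * (g s * h (suc n) s))
          ≈⟨ Σ-cong (suc n) (λ s → trans (solve 3 (λ a b c → a :* (b :* c) := b :* (a :* c)) refl _ _ _) (D-h n s)) ⟩
        Σ≤ (suc n) (λ s → c * (g s * h n s) + prev n s + γ n (suc s) * h n (suc s))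
          ≈⟨ trans (Σ-distrib-+ (suc n) _ _) (+-congʳ (Σ-distrib-+ (suc n) _ _)) ⟩
        Σ≤ (suc n) (λ s → c * (g s * h n s)) + Σ≤ (suc n) (prev n) + Σ≤ (suc n) (λ s → γ n (suc s) * h n (suc s))
          ≈⟨ +-congʳ (+-cong (Σ-truncate (ℕₚ.n≤1+n n) (λ s n<s → trans (*-congˡ (trans (*-congˡ (h-zero n<s)) (zeroʳ _))) (zeroʳ _)))
                             (Σ-head n (prev n))) ⟩
        Σ≤ n (λ s → c * (g s * h n s)) + (γ n 0 * h n 0 + Σ≤ n (λ s → Q ^ n * ĝ s * h n s)) + Σ≤ (suc n) (λ s → γ n (suc s) * h n (suc s))
          ≈⟨ solve 4 (λ a b c d → a :+ (b :+ c) :+ d := a :+ (c :+ (b :+ d))) refl _ _ _ _ ⟩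
        Σ≤ n (λ s → c * (g s * h n s)) + (Σ≤ n (λ s → Q ^ n * ĝ s * h n s) + (γ n 0 * h n 0 + Σ≤ (suc n) (λ s → γ n (suc s) * h n (suc s))))
          -- The folded term `γ n 0 * h n 0` is exactly the missing head of the shifted `γ` sum.
          ≈⟨ +-congˡ (+-congˡ (trans (sym (Σ-head (suc n) (λ s → γ n s * h n s)))
               (Σ-truncate (ℕₚ.m≤n⇒m≤1+n (ℕₚ.n≤1+n n)) (λ s n<s → trans (*-congˡ (h-zero n<s)) (zeroʳ _))))) ⟩
        Σ≤ n (λ s → c * (g s * h n s)) + (Σ≤ n (λ s → Q ^ n * ĝ s * h n s) + Σ≤ n (λ s → γ n s * h n s))
          ≈⟨ trans (Σ-distrib-+ n _ _) (+-congˡ (Σ-distrib-+ n _ _)) ⟨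
        Σ≤ n (λ s → c * (g s * h n s) + (Q ^ n * ĝ s * h n s + γ n s * h n s))
          ≈⟨ Σ-cong n collect ⟩
        Σ≤ n (λ s → (1# - x * Q ^ suc n) * (1# - y * Q ^ n) * (g s * h n s))
          ≈⟨ Σ-distribˡ-* n _ _ ⟩
        (1# - x * Q ^ suc n) * (1# - y * Q ^ n) * Σ≤ n (λ s → g s * h n s) ∎
        where
        c = 1# + Q * Q * Q ^ n * Q ^ n
        collect : ∀ s → c * (g s * h n s) + (Q ^ n * ĝ s * h n s + γ n s * h n s) ≈
          (1# - x * Q ^ suc n) * (1# - y * Q ^ n) * (g s * h n s)
        collect s = begin
          c * (g s * h n s) + (Q ^ n * ĝ s * h n s + γ n s * h n s)
            ≈⟨ +-congˡ (trans (+-comm _ _) (sym (distribʳ _ _ _))) ⟩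
          c * (g s * h n s) + (γ n s + Q ^ n * ĝ s) * h n s
            ≈⟨ +-congˡ (*-congʳ (γ+ĝ n s)) ⟩
          c * (g s * h n s) + - (Q * Q ^ n * x + Q ^ n * y) * g s * h n s
            ≈⟨ solve 5 (λ Y x y g h → let Q = x :* y in
                 (:1 :+ Q :* Q :* Y :* Y) :* (g :* h) :+ (:- (Q :* Y :* x :+ Y :* y)) :* g :* h :=
                 (:1 :- x :* (Q :* Y)) :* (:1 :- y :* Y) :* (g :* h)) refl (Q ^ n) x y (g s) (h n s) ⟩
          (1# - x * Q ^ suc n) * (1# - y * Q ^ n) * (g s * h n s) ∎

    finiteJacobi : ∀ n → pochhammer x Q (suc n) * pochhammer y Q n ≈
      pochhammer Q Q (suc (n ℕ.+ n)) * Σ≤ n (λ s → g s * h n s)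
    finiteJacobi zero = begin
      1# * (1# - x * 1#) * 1#                           ≈⟨ solve 1 (λ x → :1 :* (:1 :- x :* :1) :* :1 := :1 :* (:1 :- x)) refl x ⟩
      1# * (1# - x)                                     ≈⟨ *-congʳ (p-inverse 1) ⟨
      pochhammer Q Q 1 * p 1 * (1# - x)                 ≈⟨ *-congʳ (*-congˡ (trans (sym (*-identityˡ _)) (*-congʳ (sym p-zero)))) ⟩
      pochhammer Q Q 1 * (p 0 * p 1) * (1# - x)         ≈⟨ solve 3 (λ a b c → a :* b :* c := a :* (c :* b)) refl _ _ _ ⟩
      pochhammer Q Q 1 * ((1# - x) * (p 0 * p 1))       ∎
    finiteJacobi (suc n) = begin
      pochhammer x Q (suc n) * A * (pochhammer y Q n * B)
        ≈⟨ solve 4 (λ a b c d → a :* b :* (c :* d) := a :* c :* (b :* d)) refl _ _ _ _ ⟩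
      pochhammer x Q (suc n) * pochhammer y Q n * (A * B)
        ≈⟨ *-congʳ (finiteJacobi n) ⟩
      F * Σ≤ n (λ s → g s * h n s) * (A * B)
        ≈⟨ solve 3 (λ a b c → a :* b :* c := a :* (c :* b)) refl _ _ _ ⟩
      F * (A * B * Σ≤ n (λ s → g s * h n s))
        ≈⟨ *-congˡ (D-Σ n) ⟨
      F * (D n * Σ≤ (suc n) (λ s → g s * h (suc n) s))
        ≈⟨ solve 4 (λ a b c d → a :* (b :* c :* d) := a :* b :* c :* d) refl _ _ _ _ ⟩
      F * (1# - Q * Q * Q ^ n * Q ^ n) * (1# - Q * Q * Q * Q ^ n * Q ^ n) * Σ≤ (suc n) (λ s → g s * h (suc n) s)
        ≈⟨ *-congʳ (*-cong (*-congˡ (+-congˡ (-‿cong e1))) (+-congˡ (-‿cong e2))) ⟩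
      F * (1# - Q * Q ^ suc (n ℕ.+ n)) * (1# - Q * Q ^ suc (suc (n ℕ.+ n))) * Σ≤ (suc n) (λ s → g s * h (suc n) s)
        ≡⟨ ≡.cong (λ k → pochhammer Q Q (suc (suc k)) * Σ≤ (suc n) (λ s → g s * h (suc n) s)) (ℕₚ.+-suc n n) ⟨
      pochhammer Q Q (suc (suc n ℕ.+ suc n)) * Σ≤ (suc n) (λ s → g s * h (suc n) s) ∎
      where
      A = 1# - x * Q ^ suc n
      B = 1# - y * Q ^ n
      F = pochhammer Q Q (suc (n ℕ.+ n))
      e1 : Q * Q * Q ^ n * Q ^ n ≈ Q * (Q * Q ^ (n ℕ.+ n))
      e1 = trans (solve 2 (λ q y → q :* q :* y :* y := q :* (q :* (y :* y))) refl _ _) (*-congˡ (*-congˡ (sym (^-homo-* Q n n))))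
      e2 : Q * Q * Q * Q ^ n * Q ^ n ≈ Q * (Q * (Q * Q ^ (n ℕ.+ n)))
      e2 = trans (solve 2 (λ q y → q :* q :* q :* y :* y := q :* (q :* q :* y :* y)) refl _ _) (*-congˡ e1)

  open Theta

  -- The kernels `E r`: q-Chu-Vandermonde sum, eigenvalues of `T`, contiguous relation.

  module BaileyChain
    (q : Carrier) (p : ℕ → Carrier) (p-inverse : ∀ n → pochhammer q q n * p n ≈ 1#) where
    open Reciprocals q p p-inverse

    -- M b n = (-q^{b+1};q)_n and V b n = q^{(b+1) + ... + (b+n)}.
    M V : ℕ → ℕ → Carrier
    M b zero    = 1#
    M b (suc n) = M b n * (1# + q ^ suc (b ℕ.+ n))
    V b zero    = 1#
    V b (suc n) = V b n * q ^ suc (b ℕ.+ n)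

    M-+ : ∀ a n → M 0 a * M a n ≈ M 0 (a ℕ.+ n)
    M-+ a zero rewrite ℕₚ.+-identityʳ a = *-identityʳ _
    M-+ a (suc n) rewrite ℕₚ.+-suc a n = trans (sym (*-assoc _ _ _)) (*-congʳ (M-+ a n))

    V-+ : ∀ a n → V 0 a * V a n ≈ V 0 (a ℕ.+ n)
    V-+ a zero rewrite ℕₚ.+-identityʳ a = *-identityʳ _
    V-+ a (suc n) rewrite ℕₚ.+-suc a n = trans (sym (*-assoc _ _ _)) (*-congʳ (V-+ a n))

    cancel : ∀ n {x y} → (1# - q ^ suc n) * x ≈ (1# - q ^ suc n) * y → x ≈ y
    cancel n {x} {y} eq = trans (sym (unit x)) (trans (*-congˡ eq) (unit y))
      where
      unit : ∀ z → pochhammer q q n * p (suc n) * ((1# - q ^ suc n) * z) ≈ z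
      unit z = begin
        pochhammer q q n * p (suc n) * ((1# - q ^ suc n) * z)
          ≈⟨ solve 4 (λ a b c d → a :* b :* (c :* d) := a :* c :* b :* d) refl _ _ _ _ ⟩
        pochhammer q q (suc n) * p (suc n) * z ≈⟨ *-congʳ (p-inverse (suc n)) ⟩
        1# * z                                 ≈⟨ *-identityˡ z ⟩
        z                                      ∎

    private
      term : ℕ → ℕ → ℕ → ℕ → Carrier
      term n a b j = pm n j * p j * M 0 (a ℕ.+ j) * V b j * p (suc (a ℕ.+ b ℕ.+ j))

      term-zero : ∀ n a b → (1# - q ^ suc n) * term (suc n) a b 0 ≈ term n a b 0
      term-zero n a b = trans
        (solve 6 (λ F a b c d e → F :* (a :* b :* c :* d :* e) := a :* F :* b :* c :* d :* e) refl _ _ _ _ _ _)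
        (*-congʳ (*-congʳ (*-congʳ (*-congʳ (p-suc n)))))

      -- `V b (suc s)` contains `q^s`, and `(1 - q^{n+1}) q^s = (q^s - q^n) + q^n (1 -
      -- q^{s+1})`. The first summand is absorbed by `pm-suc`, the second by `p-suc`.
      term-suc : ∀ n a b s → (1# - q ^ suc n) * term (suc n) a b (suc s) ≈
        term n a b (suc s) + q ^ suc (n ℕ.+ b) * term n (suc a) b s
      term-suc n a b s rewrite ℕₚ.+-suc a s | ℕₚ.+-suc (a ℕ.+ b) s = begin
        (1# - q * Y) * (A * G * D * (w * (q * q ^ (b ℕ.+ s))) * e)
          ≈⟨ *-congˡ (*-congʳ (*-congˡ (*-congˡ (*-congˡ (^-homo-* q b s))))) ⟩
        (1# - q * Y) * (A * G * D * (w * (q * (B * X))) * e)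
          ≈⟨ solve 9 (λ q X Y A G D B w e →
               (:1 :- q :* Y) :* (A :* G :* D :* (w :* (q :* (B :* X))) :* e) :=
               A :* (X :- Y) :* G :* D :* (w :* (q :* B)) :* e
               :+ q :* (Y :* B) :* (A :* (G :* (:1 :- q :* X)) :* D :* w :* e)) refl q X Y A G D B w e ⟩
        A * (X - Y) * G * D * (w * (q * B)) * e + q * (Y * B) * (A * (G * (1# - q * X)) * D * w * e)
          ≈⟨ +-cong (*-congʳ (*-congʳ (*-congʳ (*-congʳ (sym (pm-suc n s))))))
                    (*-cong (*-congˡ (sym (^-homo-* q n b))) (*-congʳ (*-congʳ (*-congʳ (*-congˡ (p-suc s)))))) ⟩
        X * A₁ * G * D * (w * (q * B)) * e + q * q ^ (n ℕ.+ b) * (A * p s * D * w * e)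
          ≈⟨ +-congʳ (solve 8 (λ q X A G D B w e → X :* A :* G :* D :* (w :* (q :* B)) :* e := A :* G :* D :* (w :* (q :* (B :* X))) :* e)
                refl q X A₁ G D B w e) ⟩
        A₁ * G * D * (w * (q * (B * X))) * e + q * q ^ (n ℕ.+ b) * (A * p s * D * w * e)
          ≈⟨ +-congʳ (*-congʳ (*-congˡ (*-congˡ (*-congˡ (sym (^-homo-* q b s)))))) ⟩
        A₁ * G * D * (w * (q * q ^ (b ℕ.+ s))) * e + q * q ^ (n ℕ.+ b) * (A * p s * D * w * e) ∎
        where
        X = q ^ s
        Y = q ^ n
        B = q ^ b
        A = pm n s
        A₁ = pm n (suc s)
        G = p (suc s)
        D = M 0 (suc (a ℕ.+ s))
        w = V b s
        e = p (suc (suc (a ℕ.+ b ℕ.+ s)))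

    -- The recurrence in n shifts a by one, so a and b are kept independent.
    chuVandermonde : ∀ n a b →
      Σ≤ n (λ j → pm n j * p j * M 0 (a ℕ.+ j) * V b j * p (suc (a ℕ.+ b ℕ.+ j))) ≈
      M b n * M 0 a * p n * p (suc (a ℕ.+ b ℕ.+ n))
    chuVandermonde zero a b rewrite ℕₚ.+-identityʳ a = begin
      p 0 * p 0 * M 0 a * 1# * e    ≈⟨ *-congʳ (*-congʳ (*-congʳ (*-congˡ p-zero))) ⟩
      p 0 * 1# * M 0 a * 1# * e     ≈⟨ solve 3 (λ a b c → a :* :1 :* b :* :1 :* c := :1 :* b :* a :* c) refl _ _ _ ⟩
      1# * M 0 a * p 0 * e          ∎
      where e = p (suc (a ℕ.+ b ℕ.+ 0))
    chuVandermonde (suc n) a b = cancel n (begin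
      F * Σ≤ (suc n) (term (suc n) a b)
        ≈⟨ *-congˡ (Σ-head n (term (suc n) a b)) ⟩
      F * (term (suc n) a b 0 + Σ≤ n (term (suc n) a b ∘ suc))
        ≈⟨ trans (distribˡ _ _ _) (+-congˡ (sym (Σ-distribˡ-* n F _))) ⟩
      F * term (suc n) a b 0 + Σ≤ n (λ s → F * term (suc n) a b (suc s))
        ≈⟨ +-cong (term-zero n a b) (Σ-cong n (term-suc n a b)) ⟩
      term n a b 0 + Σ≤ n (λ s → term n a b (suc s) + q ^ suc (n ℕ.+ b) * term n (suc a) b s)
        ≈⟨ +-congˡ (trans (Σ-distrib-+ n _ _) (+-congˡ (Σ-distribˡ-* n _ _))) ⟩
      term n a b 0 + (Σ≤ n (term n a b ∘ suc) + q ^ suc (n ℕ.+ b) * Σ≤ n (term n (suc a) b))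
        ≈⟨ +-assoc _ _ _ ⟨
      term n a b 0 + Σ≤ n (term n a b ∘ suc) + q ^ suc (n ℕ.+ b) * Σ≤ n (term n (suc a) b)
        ≈⟨ +-congʳ (trans (sym (Σ-head n (term n a b))) (Σ-truncate (ℕₚ.n≤1+n n) vanish)) ⟩
      Σ≤ n (term n a b) + q ^ suc (n ℕ.+ b) * Σ≤ n (term n (suc a) b)
        ≈⟨ +-cong (chuVandermonde n a b) (*-congˡ (chuVandermonde n (suc a) b)) ⟩
      M b n * M 0 a * p n * p (suc (a ℕ.+ b ℕ.+ n)) + q ^ suc (n ℕ.+ b) * (M b n * M 0 (suc a) * p n * e)
        ≈⟨ +-cong (*-cong (*-congˡ (sym (p-suc n))) (sym e-suc)) (*-cong (*-congˡ (^-homo-* q n b)) (*-congʳ (*-congˡ (sym (p-suc n))))) ⟩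
      M b n * M 0 a * (p (suc n) * F) * (e * (1# - q * (q * (A * B * Y))))
        + q * (Y * B) * (M b n * (M 0 a * (1# + q * A)) * (p (suc n) * F) * e)
        -- Since `1 - q^{a+b+n+2} + q^{b+n+1} (1 + q^{a+1}) = 1 + q^{b+n+1}`, the two sums combine
        -- to the new factor of `M b (suc n)`.
        ≈⟨ solve 8 (λ q A B Y m n p e → let F = :1 :- q :* Y in
             m :* n :* (p :* F) :* (e :* (:1 :- q :* (q :* (A :* B :* Y))))
               :+ q :* (Y :* B) :* (m :* (n :* (:1 :+ q :* A)) :* (p :* F) :* e) :=
             F :* (m :* (:1 :+ q :* (B :* Y)) :* n :* p :* e)) refl q A B Y (M b n) (M 0 a) (p (suc n)) e ⟩
      F * (M b n * (1# + q * (B * Y)) * M 0 a * p (suc n) * e)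
        ≈⟨ *-congˡ (*-congʳ (*-congʳ (*-congʳ (*-congˡ (+-congˡ (*-congˡ (sym (^-homo-* q b n)))))))) ⟩
      F * (M b (suc n) * M 0 a * p (suc n) * e)
        ≡⟨ ≡.cong (λ k → F * (M b (suc n) * M 0 a * p (suc n) * p (suc k))) (ℕₚ.+-suc (a ℕ.+ b) n) ⟨
      F * (M b (suc n) * M 0 a * p (suc n) * p (suc (a ℕ.+ b ℕ.+ suc n))) ∎)
      where
      F = 1# - q ^ suc n
      A = q ^ a
      B = q ^ b
      Y = q ^ n
      e = p (suc (suc (a ℕ.+ b ℕ.+ n)))
      vanish : ∀ j → n < j → term n a b j ≈ 0#
      vanish j n<j = trans (*-congʳ (*-congʳ (*-congʳ (*-congʳ (pm-zero n<j)))))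
        (solve 4 (λ a b c d → :0 :* a :* b :* c :* d := :0) refl _ _ _ _)
      e-suc : e * (1# - q * (q * (A * B * Y))) ≈ p (suc (a ℕ.+ b ℕ.+ n))
      e-suc = trans (*-congˡ (+-congˡ (-‿cong (*-congˡ (*-congˡ
        (sym (trans (^-homo-* q (a ℕ.+ b) n) (*-congʳ (^-homo-* q a b)))))))))
        (p-suc _)

    E : ℕ → ℕ → Carrier
    E r L = M 0 L * h L r

    E-zero : ∀ {r L} → L < r → E r L ≈ 0#
    E-zero L<r = trans (*-congˡ (h-zero L<r)) (zeroʳ _)

    -- With `y = r + j` this is `chuVandermonde` at `a = b = r`; the eigenvalue is split off from
    -- `V 0 (r + j) = V 0 r * V r j`.
    E-eigen : ∀ r L → Σ≤ L (λ y → pm L y * (V 0 y * E r y)) ≈ V 0 r * E r L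
    E-eigen r L with ℕₚ.≤-<-connex r L
    ... | inj₂ L<r = trans (Σ-zero L (λ y y≤L → trans (*-congˡ (trans (*-congˡ (E-zero (ℕₚ.≤-<-trans y≤L L<r))) (zeroʳ _))) (zeroʳ _)))
                           (sym (trans (*-congˡ (E-zero L<r)) (zeroʳ _)))
    ... | inj₁ r≤L = ≡.subst (λ L → Σ≤ L (λ y → pm L y * (V 0 y * E r y)) ≈ V 0 r * E r L)
                       (ℕₚ.m+[n∸m]≡n r≤L) (shifted (L ℕ.∸ r))
      where
      E-shift : ∀ j → E r (r ℕ.+ j) ≡ M 0 (r ℕ.+ j) * (p j * p (suc (r ℕ.+ r ℕ.+ j)))
      E-shift j = ≡.cong₂ (λ z k → M 0 (r ℕ.+ j) * (z * p (suc k)))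
        (≡.trans (≡.cong (pm (r ℕ.+ j)) (≡.sym (ℕₚ.+-identityʳ r))) (pm-+ r j 0))
        (≡.trans (ℕₚ.+-assoc r j r) (≡.trans (≡.cong (r ℕ.+_) (ℕₚ.+-comm j r)) (≡.sym (ℕₚ.+-assoc r r j))))
      shifted : ∀ n → Σ≤ (r ℕ.+ n) (λ y → pm (r ℕ.+ n) y * (V 0 y * E r y)) ≈ V 0 r * E r (r ℕ.+ n)
      shifted n = begin
        Σ≤ (r ℕ.+ n) (λ y → pm (r ℕ.+ n) y * (V 0 y * E r y))
          ≈⟨ Σ-drop r n (λ y y<r → trans (*-congˡ (trans (*-congˡ (E-zero y<r)) (zeroʳ _))) (zeroʳ _)) ⟩
        Σ≤ n (λ j → pm (r ℕ.+ n) (r ℕ.+ j) * (V 0 (r ℕ.+ j) * E r (r ℕ.+ j)))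
          ≈⟨ Σ-cong n (λ j → trans
               (*-cong (reflexive (pm-+ r n j)) (*-cong (sym (V-+ r j)) (reflexive (E-shift j))))
               (solve 6 (λ a b c d e f → a :* (b :* c :* (d :* (e :* f))) := b :* (a :* e :* d :* c :* f)) refl _ _ _ _ _ _)) ⟩
        Σ≤ n (λ j → V 0 r * term n r r j)
          ≈⟨ Σ-distribˡ-* n _ _ ⟩
        V 0 r * Σ≤ n (term n r r)
          ≈⟨ *-congˡ (chuVandermonde n r r) ⟩
        V 0 r * (M r n * M 0 r * p n * p (suc (r ℕ.+ r ℕ.+ n)))
          ≈⟨ *-congˡ (trans (*-congʳ (*-congʳ (trans (*-comm _ _) (M-+ r n)))) (*-assoc _ _ _)) ⟩
        V 0 r * (M 0 (r ℕ.+ n) * (p n * p (suc (r ℕ.+ r ℕ.+ n))))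
          ≡⟨ ≡.cong (V 0 r *_) (E-shift n) ⟨
        V 0 r * E r (r ℕ.+ n) ∎

    -- Terms with `s > L` vanish, so the upper end may be any `K ≥ L`. One `K` then serves all
    -- arguments summed over in `T`, where the two sums are to be exchanged.
    Expands : (ℕ → Carrier) → (ℕ → Carrier) → Set ℓ
    Expands f c = ∀ L K → L ≤ K → f L ≈ Σ≤ K (λ s → c s * E s L)

    Expands-cong : ∀ {f f′ c c′} → (∀ L → f L ≈ f′ L) → (∀ s → c s ≈ c′ s) → Expands f c → Expands f′ c′
    Expands-cong f≈f′ c≈c′ ex L K L≤K =
      trans (sym (f≈f′ L)) (trans (ex L K L≤K) (Σ-cong K (λ s → *-congʳ (c≈c′ s))))

    V*u : ∀ x y s → V 0 s * u x y s ≈ u x (q * y) s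
    V*u x y zero    = *-identityˡ 1#
    V*u x y (suc s) = begin
      V 0 s * (q * q ^ s) * - (u x y s * (x * y) ^ s * y)
        ≈⟨ solve 6 (λ V q X u Z y → V :* (q :* X) :* :- (u :* Z :* y) := :- (V :* u :* (X :* Z) :* (q :* y))) refl _ _ _ _ _ _ ⟩
      - (V 0 s * u x y s * (q ^ s * (x * y) ^ s) * (q * y))
        ≈⟨ -‿cong (*-congʳ (*-cong (V*u x y s) (trans (sym (^-distrib-* q (x * y) s)) (^-congˡ s (solve 3 (λ q x y → q :* (x :* y) := x :* (q :* y)) refl q x y))))) ⟩
      - (u x (q * y) s * (x * (q * y)) ^ s * (q * y)) ∎

    V*v : ∀ x y s → V 0 s * v x y s ≈ v x (q * y) s
    V*v x y zero    = *-identityˡ x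
    V*v x y (suc s) = begin
      V 0 s * q ^ suc s * - (v x y s * (x * y) ^ suc s * x)
        ≈⟨ solve 5 (λ V X v Z x → V :* X :* :- (v :* Z :* x) := :- (V :* v :* (X :* Z) :* x)) refl _ _ _ _ _ ⟩
      - (V 0 s * v x y s * (q ^ suc s * (x * y) ^ suc s) * x)
        ≈⟨ -‿cong (*-congʳ (*-cong (V*v x y s) (trans (sym (^-distrib-* q (x * y) (suc s))) (^-congˡ (suc s) (solve 3 (λ q x y → q :* (x :* y) := x :* (q :* y)) refl q x y))))) ⟩
      - (v x (q * y) s * (x * (q * y)) ^ suc s * x) ∎

    V*g : ∀ x y s → V 0 s * g x y s ≈ g x (q * y) s
    V*g x y s = trans (solve 3 (λ a b c → a :* (b :- c) := a :* b :- a :* c) refl _ _ _)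
                      (+-cong (V*u x y s) (-‿cong (V*v x y s)))

    -- The theta terms at `n = -s` and `n = s+1` carry the same power of `xy` and differ by
    -- `x^{2s+1}`; at `x = q` this makes `g q y s` equal to `(1 - q^{2s+1}) u q y s`.
    v-q : ∀ y s → v q y s ≈ u q y s * (q * q ^ s * q ^ s)
    v-q y zero    = solve 1 (λ q → q := :1 :* (q :* :1 :* :1)) refl q
    v-q y (suc s) = begin
      - (v q y s * (q * y * (q * y) ^ s) * q)
        ≈⟨ -‿cong (*-congʳ (*-congʳ (v-q y s))) ⟩
      - (u q y s * (q * q ^ s * q ^ s) * (q * y * (q * y) ^ s) * q)
        ≈⟨ solve 5 (λ u q X y Z → :- (u :* (q :* X :* X) :* (q :* y :* Z) :* q) := :- (u :* Z :* y) :* (q :* (q :* X) :* (q :* X))) refl _ _ _ _ _ ⟩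
      - (u q y s * (q * y) ^ s * y) * (q * (q * q ^ s) * (q * q ^ s)) ∎

    -- The reflection `n ↦ -n` exchanges `x` and `y`, and takes `n = s+1` to the index `-(s+1)` of
    -- `u`. `u-swap` is the opposite half, with `v-q` inserted.
    v-swap : ∀ y s → - v y q s ≈ u q y (suc s)
    v-swap y zero    = -‿cong (solve 1 (λ y → y := :1 :* :1 :* y) refl y)
    v-swap y (suc s) = begin
      - - (v y q s * (y * q) ^ suc s * y)
        ≈⟨ solve 3 (λ a b c → :- :- (a :* b :* c) := :- ((:- a) :* b :* c)) refl _ _ _ ⟩
      - (- v y q s * (y * q) ^ suc s * y)
        ≈⟨ -‿cong (*-congʳ (*-cong (v-swap y s) (^-congˡ (suc s) (*-comm y q)))) ⟩
      - (u q y (suc s) * (q * y) ^ suc s * y) ∎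

    u-swap : ∀ y s → u y q (suc s) ≈ - (u q y s * (q * q ^ s * q ^ s))
    u-swap y zero    = -‿cong (solve 1 (λ q → :1 :* :1 :* q := :1 :* (q :* :1 :* :1)) refl q)
    u-swap y (suc s) = begin
      - (u y q (suc s) * (y * q) ^ suc s * q)
        ≈⟨ -‿cong (*-congʳ (*-cong (u-swap y s) (^-congˡ (suc s) (*-comm y q)))) ⟩
      - (- (u q y s * (q * q ^ s * q ^ s)) * (q * y * (q * y) ^ s) * q)
        ≈⟨ solve 5 (λ u q X y Z → :- ((:- (u :* (q :* X :* X))) :* (q :* y :* Z) :* q) := :- ((:- (u :* Z :* y)) :* (q :* (q :* X) :* (q :* X)))) refl _ _ _ _ _ ⟩
      - (- (u q y s * (q * y) ^ s * y) * (q * (q * q ^ s) * (q * q ^ s))) ∎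

    -- E⁻ L r plays the role of E (r - 1) L, with E (-1) L = E 0 L.
    E⁻ : ℕ → ℕ → Carrier
    E⁻ L r = M 0 L * (pm (suc L) r * p (L ℕ.+ r))

    E⁻-zero : ∀ L → E⁻ L 0 ≈ E 0 L
    E⁻-zero L rewrite ℕₚ.+-identityʳ L = *-congˡ (*-comm _ _)

    E⁻-suc : ∀ L s → E⁻ L (suc s) ≈ E s L
    E⁻-suc L s rewrite ℕₚ.+-suc L s = refl

    -- For `X = q^r` and `Z = q^{L+1}`: `(1 - qX^2) (1 - Z^2) = (1 - XZ) (1 - qXZ) - (X - Z) (qX -
    -- Z)`. The factor `1 - q^{L+1}` of `S` meets the last factor `1 + q^{L+1}` of `M 0 (suc
    -- L)` to form `1 - Z^2`.
    E-contiguous : ∀ L r → (1# - q * q ^ r * q ^ r) * ((1# - q ^ suc L) * E r (suc L)) ≈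
      E⁻ L r - q * q ^ r * q ^ r * E (suc r) L
    E-contiguous L r rewrite ℕₚ.+-suc L r = begin
      (1# - q * X * X) * ((1# - q * Y) * (m * (1# + q * Y) * (a * b)))
        ≈⟨ solve 6 (λ q X Y m a b →
             (:1 :- q :* X :* X) :* ((:1 :- q :* Y) :* (m :* (:1 :+ q :* Y) :* (a :* b))) :=
             m :* (a :* (b :* (:1 :- q :* (q :* (Y :* X))) :* (:1 :- q :* (Y :* X))))
               :- m :* (a :* (X :- q :* Y) :* (q :* X :- q :* Y) :* b)) refl q X Y m a b ⟩
      m * (a * (b * (1# - q * (q * (Y * X))) * (1# - q * (Y * X)))) - m * (a * (X - q * Y) * (q * X - q * Y) * b)
        ≈⟨ +-cong (*-congˡ (*-congˡ b2)) (-‿cong (*-congˡ (*-congʳ a2))) ⟩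
      m * (a * p (L ℕ.+ r)) - m * (X * (q * X * pm L (suc r)) * b)
        ≈⟨ +-congˡ (-‿cong (solve 5 (λ m X q c b → m :* (X :* (q :* X :* c) :* b) := q :* X :* X :* (m :* (c :* b))) refl _ _ _ _ _)) ⟩
      m * (a * p (L ℕ.+ r)) - q * X * X * (m * (pm L (suc r) * b)) ∎
      where
      X = q ^ r
      Y = q ^ L
      m = M 0 L
      a = pm (suc L) r
      b = p (suc (suc (L ℕ.+ r)))
      b2 : b * (1# - q * (q * (Y * X))) * (1# - q * (Y * X)) ≈ p (L ℕ.+ r)
      b2 = begin
        b * (1# - q * (q * (Y * X))) * (1# - q * (Y * X))
          ≈⟨ *-cong (*-congˡ (+-congˡ (-‿cong (*-congˡ (*-congˡ (^-homo-* q L r)))))) (+-congˡ (-‿cong (*-congˡ (^-homo-* q L r)))) ⟨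
        b * (1# - q ^ suc (suc (L ℕ.+ r))) * (1# - q ^ suc (L ℕ.+ r))
          ≈⟨ trans (*-congʳ (p-suc _)) (p-suc _) ⟩
        p (L ℕ.+ r) ∎
      a2 : a * (X - q * Y) * (q * X - q * Y) ≈ X * (q * X * pm L (suc r))
      a2 = begin
        a * (X - q * Y) * (q * X - q * Y)             ≈⟨ *-congʳ (pm-suc (suc L) r) ⟨
        X * pm (suc L) (suc r) * (q * X - q * Y)      ≈⟨ *-assoc _ _ _ ⟩
        X * (pm (suc L) (suc r) * (q * X - q * Y))    ≈⟨ *-congˡ (pm-suc (suc L) (suc r)) ⟨
        X * (q * X * pm L (suc r))                    ∎

    -- `E s L` collects `u q y (s+1)` from `r = s+1` and `- u q y (s-1) q^{2s-1}` from `r = s-1`,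
    -- which the swap lemmas identify as `- v y q s` and `u y q s`. At `s = 0` the second is
    -- replaced by `E⁻ L 0 = E 0 L`, with coefficient `u y q 0 = 1`.
    shift-expands : ∀ {f y} → Expands f (g q y) → Expands (λ L → (1# - q ^ suc L) * f (suc L)) (g y q)
    shift-expands {f} {y} ex L K L≤K = begin
      (1# - q ^ suc L) * f (suc L)
        ≈⟨ *-congˡ (ex (suc L) (suc K) (s≤s L≤K)) ⟩
      (1# - q ^ suc L) * Σ≤ (suc K) (λ r → g q y r * E r (suc L))
        ≈⟨ Σ-distribˡ-* (suc K) _ _ ⟨
      Σ≤ (suc K) (λ r → (1# - q ^ suc L) * (g q y r * E r (suc L)))
        ≈⟨ Σ-cong (suc K) split ⟩
      Σ≤ (suc K) (λ r → u q y r * E⁻ L r + u y q (suc r) * E (suc r) L)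
        ≈⟨ Σ-distrib-+ (suc K) _ _ ⟩
      Σ≤ (suc K) (λ r → u q y r * E⁻ L r) + Σ≤ (suc K) (λ r → u y q (suc r) * E (suc r) L)
        ≈⟨ +-congʳ (Σ-head K _) ⟩
      1# * E⁻ L 0 + Σ≤ K (λ s → u q y (suc s) * E⁻ L (suc s)) + Σ≤ (suc K) (λ r → u y q (suc r) * E (suc r) L)
        ≈⟨ +-congʳ (+-cong (*-congˡ (E⁻-zero L)) (Σ-cong K (λ s → *-cong (sym (v-swap y s)) (E⁻-suc L s)))) ⟩
      1# * E 0 L + Σ≤ K (λ s → - v y q s * E s L) + Σ≤ (suc K) (λ r → u y q (suc r) * E (suc r) L)
        ≈⟨ solve 3 (λ a b c → a :+ b :+ c := a :+ c :+ b) refl _ _ _ ⟩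
      1# * E 0 L + Σ≤ (suc K) (λ r → u y q (suc r) * E (suc r) L) + Σ≤ K (λ s → - v y q s * E s L)
        ≈⟨ +-congʳ (Σ-head (suc K) (λ s → u y q s * E s L)) ⟨
      Σ≤ (suc (suc K)) (λ s → u y q s * E s L) + Σ≤ K (λ s → - v y q s * E s L)
        ≈⟨ +-congʳ (Σ-truncate (ℕₚ.m≤n⇒m≤1+n (ℕₚ.n≤1+n K)) (λ s K<s → trans (*-congˡ (E-zero (ℕₚ.≤-<-trans L≤K K<s))) (zeroʳ _))) ⟩
      Σ≤ K (λ s → u y q s * E s L) + Σ≤ K (λ s → - v y q s * E s L)
        ≈⟨ Σ-distrib-+ K _ _ ⟨
      Σ≤ K (λ s → u y q s * E s L + - v y q s * E s L)
        ≈⟨ Σ-cong K (λ s → sym (distribʳ _ _ _)) ⟩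
      Σ≤ K (λ s → g y q s * E s L) ∎
      where
      split : ∀ r → (1# - q ^ suc L) * (g q y r * E r (suc L)) ≈ u q y r * E⁻ L r + u y q (suc r) * E (suc r) L
      split r = begin
        (1# - q ^ suc L) * ((u q y r - v q y r) * E r (suc L))
          ≈⟨ *-congˡ (*-congʳ (+-congˡ (-‿cong (v-q y r)))) ⟩
        (1# - q ^ suc L) * ((u q y r - u q y r * (q * q ^ r * q ^ r)) * E r (suc L))
          ≈⟨ solve 4 (λ F u z E → F :* ((u :- u :* z) :* E) := u :* ((:1 :- z) :* (F :* E))) refl _ _ _ _ ⟩
        u q y r * ((1# - q * q ^ r * q ^ r) * ((1# - q ^ suc L) * E r (suc L)))
          ≈⟨ *-congˡ (E-contiguous L r) ⟩
        u q y r * (E⁻ L r - q * q ^ r * q ^ r * E (suc r) L)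
          ≈⟨ solve 4 (λ u A z E → u :* (A :- z :* E) := u :* A :+ (:- (u :* z)) :* E) refl _ _ _ _ ⟩
        u q y r * E⁻ L r + - (u q y r * (q * q ^ r * q ^ r)) * E (suc r) L
          ≈⟨ +-congˡ (*-congʳ (u-swap y r)) ⟨
        u q y r * E⁻ L r + u y q (suc r) * E (suc r) L ∎

  module ThetaProperties where

    pochhammer-cong : ∀ {x x′ Q Q′} → x ≈ x′ → Q ≈ Q′ → ∀ n → pochhammer x Q n ≈ pochhammer x′ Q′ n
    pochhammer-cong x≈ Q≈ zero    = refl
    pochhammer-cong x≈ Q≈ (suc n) =
      *-cong (pochhammer-cong x≈ Q≈ n) (+-congˡ (-‿cong (*-cong x≈ (^-congˡ n Q≈))))

    u-cong : ∀ {x x′ y y′} → x ≈ x′ → y ≈ y′ → ∀ s → u x y s ≈ u x′ y′ s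
    u-cong x≈ y≈ zero    = refl
    u-cong x≈ y≈ (suc s) = -‿cong (*-cong (*-cong (u-cong x≈ y≈ s) (^-congˡ s (*-cong x≈ y≈))) y≈)

    v-cong : ∀ {x x′ y y′} → x ≈ x′ → y ≈ y′ → ∀ s → v x y s ≈ v x′ y′ s
    v-cong x≈ y≈ zero    = x≈
    v-cong x≈ y≈ (suc s) = -‿cong (*-cong (*-cong (v-cong x≈ y≈ s) (^-congˡ (suc s) (*-cong x≈ y≈))) x≈)

    g-cong : ∀ {x x′ y y′} → x ≈ x′ → y ≈ y′ → ∀ s → g x y s ≈ g x′ y′ s
    g-cong x≈ y≈ s = +-cong (u-cong x≈ y≈ s) (-‿cong (v-cong x≈ y≈ s))

  open ThetaProperties

  -- Limits for a nilpotent base, and the infinite triple product.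

  module Nilpotent
    (Q : Carrier) (ν : ℕ) (Q^≈0 : Q ^ suc ν ≈ 0#) where

    ^-vanish : ∀ {k} → ν < k → Q ^ k ≈ 0#
    ^-vanish {k} ν<k = begin
      Q ^ k                             ≡⟨ ≡.cong (Q ^_) (ℕₚ.m+[n∸m]≡n ν<k) ⟨
      Q ^ (suc ν ℕ.+ (k ∸ suc ν))       ≈⟨ ^-homo-* Q (suc ν) (k ∸ suc ν) ⟩
      Q ^ suc ν * Q ^ (k ∸ suc ν)       ≈⟨ *-congʳ Q^≈0 ⟩
      0# * Q ^ (k ∸ suc ν)              ≈⟨ zeroˡ _ ⟩
      0#                                ∎

    pochhammer-step : ∀ x k → x * Q ^ k ≈ 0# → pochhammer x Q (suc k) ≈ pochhammer x Q k
    pochhammer-step x k eq = trans (*-congˡ (+-congˡ (-‿cong eq)))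
      (solve 1 (λ a → a :* (:1 :- :0) := a) refl _)

    pochhammer-stable : ∀ x {k} → suc ν ≤ k → pochhammer x Q k ≈ pochhammer x Q (suc ν)
    pochhammer-stable x {k} ν<k = ≡.subst (λ k → pochhammer x Q k ≈ _) (ℕₚ.m∸n+n≡m ν<k) (go (k ∸ suc ν))
      where
      go : ∀ j → pochhammer x Q (j ℕ.+ suc ν) ≈ pochhammer x Q (suc ν)
      go zero    = refl
      go (suc j) = trans (pochhammer-step x (j ℕ.+ suc ν)
        (trans (*-congˡ (^-vanish (ℕₚ.m≤n+m (suc ν) j))) (zeroʳ x))) (go j)

    module Limits (p : ℕ → Carrier) (p-inverse : ∀ n → pochhammer Q Q n * p n ≈ 1#) where
      open Reciprocals Q p p-inverse

      p-stable : ∀ {k} → ν ≤ k → p k ≈ p ν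
      p-stable {k} ν≤k = ≡.subst (λ k → p k ≈ _) (ℕₚ.m∸n+n≡m ν≤k) (go (k ∸ ν))
        where
        go : ∀ j → p (j ℕ.+ ν) ≈ p ν
        go zero    = refl
        go (suc j) = begin
          p (suc (j ℕ.+ ν))                               ≈⟨ solve 1 (λ a → a := a :* (:1 :- :0)) refl _ ⟩
          p (suc (j ℕ.+ ν)) * (1# - 0#)                   ≈⟨ *-congˡ (+-congˡ (-‿cong (^-vanish (s≤s (ℕₚ.m≤n+m ν j))))) ⟨
          p (suc (j ℕ.+ ν)) * (1# - Q ^ suc (j ℕ.+ ν))    ≈⟨ p-suc (j ℕ.+ ν) ⟩
          p (j ℕ.+ ν)                                     ≈⟨ go j ⟩
          p ν                                             ∎

      pm-stable : ∀ {L s} → s ℕ.+ ν ≤ L → pm L s ≈ p ν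
      pm-stable {L} {s} s+ν≤L = trans (reflexive (pm-∸ (ℕₚ.m+n≤o⇒m≤o s s+ν≤L)))
        (p-stable (≡.subst (_≤ L ∸ s) (ℕₚ.m+n∸m≡n s ν) (ℕₚ.∸-monoˡ-≤ s s+ν≤L)))

      -- Only `s ≤ ν` survive, and `2ν ≤ L` keeps `L - s ≥ ν` there, so both factors of `h L s` have
      -- reached `p ν`.
      Σ-h-limit : ∀ {L c} → ν ℕ.+ ν ≤ L → (∀ s → ν < s → c s ≈ 0#) →
        Σ≤ L (λ s → c s * h L s) ≈ p ν * p ν * Σ≤ ν c
      Σ-h-limit {L} {c} 2ν≤L c≈0 = begin
        Σ≤ L (λ s → c s * h L s)
          ≈⟨ Σ-truncate (ℕₚ.m+n≤o⇒m≤o ν 2ν≤L) (λ s ν<s → trans (*-congʳ (c≈0 s ν<s)) (zeroˡ _)) ⟩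
        Σ≤ ν (λ s → c s * h L s)
          ≈⟨ Σ-cong≤ ν (λ s s≤ν → trans (*-congˡ (*-cong (pm-stable (ℕₚ.≤-trans (ℕₚ.+-monoˡ-≤ ν s≤ν) 2ν≤L))
               (p-stable (ℕₚ.m≤n⇒m≤1+n (ℕₚ.≤-trans (ℕₚ.m+n≤o⇒m≤o ν 2ν≤L) (ℕₚ.m≤m+n L s)))))) (*-comm _ _)) ⟩
        Σ≤ ν (λ s → p ν * p ν * c s)
          ≈⟨ Σ-distribˡ-* ν _ _ ⟩
        p ν * p ν * Σ≤ ν c ∎

  module TripleProductLimit
    (x y : Carrier) (p : ℕ → Carrier) (p-inverse : ∀ n → pochhammer (x * y) (x * y) n * p n ≈ 1#)
    (ν : ℕ) (Q^≈0 : (x * y) ^ suc ν ≈ 0#) (g≈0 : ∀ s → ν < s → g x y s ≈ 0#) where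
    private Q = x * y
    open Nilpotent Q ν Q^≈0
    open Limits p p-inverse
    open JacobiTripleProduct x y p p-inverse

    jacobi : ∀ B → suc ν ≤ B →
      pochhammer x Q B * pochhammer y Q B * pochhammer Q Q B ≈ Σ≤ ν (g x y)
    jacobi B ν<B = begin
      pochhammer x Q B * pochhammer y Q B * pochhammer Q Q B
        ≈⟨ *-cong (*-cong (trans (pochhammer-stable x ν<B) (sym (pochhammer-stable x (s≤s ν≤n))))
                          (trans (pochhammer-stable y ν<B) (sym (pochhammer-stable y ν<n)))) (pochhammer-stable Q ν<B) ⟩
      pochhammer x Q (suc n) * pochhammer y Q n * F
        ≈⟨ *-congʳ (finiteJacobi n) ⟩
      pochhammer Q Q (suc (n ℕ.+ n)) * Σ≤ n (λ s → g x y s * Truncated.h p n s) * F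
        ≈⟨ *-congʳ (*-cong (pochhammer-stable Q (s≤s (ℕₚ.≤-trans ν≤n (ℕₚ.m≤m+n n n))))
                           (Σ-h-limit (ℕₚ.m≤n⇒m≤1+n ℕₚ.≤-refl) g≈0)) ⟩
      F * (p ν * p ν * Σ≤ ν (g x y)) * F
        ≈⟨ solve 3 (λ F p s → F :* (p :* p :* s) :* F := F :* p :* (F :* p) :* s) refl _ _ _ ⟩
      F * p ν * (F * p ν) * Σ≤ ν (g x y)
        ≈⟨ *-congʳ (*-cong Fp Fp) ⟩
      1# * 1# * Σ≤ ν (g x y)
        ≈⟨ solve 1 (λ a → :1 :* :1 :* a := a) refl _ ⟩
      Σ≤ ν (g x y) ∎
      where
      -- `2ν` is what `Σ-h-limit` asks for; one more ensures `ν < n` also when `ν = 0`.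
      n = suc (ν ℕ.+ ν)
      F = pochhammer Q Q (suc ν)
      ν≤n : ν ≤ n
      ν≤n = ℕₚ.m≤n⇒m≤1+n (ℕₚ.m≤m+n ν ν)
      ν<n : ν < n
      ν<n = s≤s (ℕₚ.m≤m+n ν ν)
      Fp : F * p ν ≈ 1#
      Fp = trans (*-congˡ (sym (p-stable (ℕₚ.n≤1+n ν)))) (p-inverse (suc ν))

  -- The operators `T` and `S` on the nested sum, and Euler's identity.

  module Chain
    (q : Carrier) (p : ℕ → Carrier) (p-inverse : ∀ n → pochhammer q q n * p n ≈ 1#)
    (ν : ℕ) (q^≈0 : q ^ suc ν ≈ 0#) (B : ℕ) (ν<B : ν < B) where
    open Reciprocals q p p-inverse
    open BaileyChain q p p-inverse
    open Nilpotent q ν q^≈0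
    open Limits p p-inverse

    V-vanish : ∀ {s} → ν < s → V 0 s ≈ 0#
    V-vanish {suc s} ν<s = trans (*-congˡ (^-vanish ν<s)) (zeroʳ _)

    g-vanish : ∀ x y s → ν < s → g x (q * y) s ≈ 0#
    g-vanish x y s ν<s = trans (sym (V*g x y s)) (trans (*-congʳ (V-vanish ν<s)) (zeroˡ _))

    -- Cut off at the side `B` of the summation box, as in the multisum. `T-exact` restores the
    -- bound `L`: `V 0 y` vanishes for `y > ν` and `pm L y` for `y > L`.
    T : (ℕ → Carrier) → ℕ → Carrier
    T f L = Σ≤ B (λ y → pm L y * (V 0 y * f y))

    T-exact : ∀ f L → T f L ≈ Σ≤ L (λ y → pm L y * (V 0 y * f y))
    T-exact f L = trans
      (sym (Σ-truncate (ℕₚ.m≤m+n B L) (λ y B<y → trans (*-congˡ (trans (*-congʳ (V-vanish (ℕₚ.<-trans ν<B B<y))) (zeroˡ _))) (zeroʳ _))))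
      (Σ-truncate (ℕₚ.m≤n+m L B) (λ y L<y → trans (*-congʳ (pm-zero L<y)) (zeroˡ _)))

    T-expands : ∀ {f x y} → Expands f (g x y) → Expands (T f) (g x (q * y))
    T-expands {f} {x} {y} ex L K L≤K = begin
      T f L
        ≈⟨ T-exact f L ⟩
      Σ≤ L (λ z → pm L z * (V 0 z * f z))
        ≈⟨ Σ-cong≤ L (λ z z≤L → trans (*-congˡ (*-congˡ (ex z K (ℕₚ.≤-trans z≤L L≤K))))
             (trans (sym (*-assoc _ _ _)) (trans (sym (Σ-distribˡ-* K _ _)) (Σ-cong K (λ s →
               solve 4 (λ a b c d → a :* b :* (c :* d) := c :* (a :* (b :* d))) refl _ _ _ _))))) ⟩
      Σ≤ L (λ z → Σ≤ K (λ s → g x y s * (pm L z * (V 0 z * E s z))))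
        ≈⟨ Σ-swap L K _ ⟩
      Σ≤ K (λ s → Σ≤ L (λ z → g x y s * (pm L z * (V 0 z * E s z))))
        ≈⟨ Σ-cong K (λ s → trans (Σ-distribˡ-* L _ _) (*-congˡ (E-eigen s L))) ⟩
      Σ≤ K (λ s → g x y s * (V 0 s * E s L))
        ≈⟨ Σ-cong K (λ s → trans (solve 3 (λ a b c → a :* (b :* c) := b :* a :* c) refl _ _ _) (*-congʳ (V*g x y s))) ⟩
      Σ≤ K (λ s → g x (q * y) s * E s L) ∎

    δ₀ : ℕ → Carrier
    δ₀ zero    = 1#
    δ₀ (suc _) = 0#

    pochhammer-1 : ∀ Q n → pochhammer 1# Q (suc n) ≈ 0#
    pochhammer-1 Q zero    = solve 0 (:1 :* (:1 :- :1 :* :1) := :0) refl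
    pochhammer-1 Q (suc n) = trans (*-congʳ (pochhammer-1 Q n)) (zeroˡ _)

    -- At `y = 1` the product side of `finiteJacobi` contains `(1;q)_L`, which is zero for `L ≥ 1`;
    -- as `(q)_{2L+1}` is a unit, the sum vanishes too.
    δ₀-expands : Expands δ₀ (g q 1#)
    δ₀-expands L K L≤K = begin
      δ₀ L
        ≈⟨ evaluate L ⟨
      M 0 L * Σ≤ L (λ s → g q 1# s * h L s)
        ≈⟨ Σ-distribˡ-* L _ _ ⟨
      Σ≤ L (λ s → M 0 L * (g q 1# s * h L s))
        ≈⟨ Σ-cong L (λ s → solve 3 (λ a b c → a :* (b :* c) := b :* (a :* c)) refl _ _ _) ⟩
      Σ≤ L (λ s → g q 1# s * E s L)
        ≈⟨ Σ-truncate L≤K (λ s L<s → trans (*-congˡ (E-zero L<s)) (zeroʳ _)) ⟨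
      Σ≤ K (λ s → g q 1# s * E s L) ∎
      where
      inverse′ : ∀ n → pochhammer (q * 1#) (q * 1#) n * p n ≈ 1#
      inverse′ n = trans (*-congʳ (pochhammer-cong (*-identityʳ q) (*-identityʳ q) n)) (p-inverse n)
      open JacobiTripleProduct q 1# p inverse′
      evaluate : ∀ L → M 0 L * Σ≤ L (λ s → g q 1# s * h L s) ≈ δ₀ L
      evaluate zero = begin
        1# * ((1# - q) * (p 0 * p 1))             ≈⟨ *-congˡ (*-congˡ (*-congʳ p-zero)) ⟩
        1# * ((1# - q) * (1# * p 1))              ≈⟨ solve 2 (λ q p → :1 :* ((:1 :- q) :* (:1 :* p)) := :1 :* (:1 :- q :* :1) :* p) refl q (p 1) ⟩
        pochhammer q q 1 * p 1                    ≈⟨ p-inverse 1 ⟩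
        1#                                        ∎
      evaluate (suc L) = begin
        M 0 (suc L) * S
          ≈⟨ *-congˡ (trans (sym (*-identityˡ S)) (*-congʳ (sym (inverse′ n)))) ⟩
        M 0 (suc L) * (pochhammer (q * 1#) (q * 1#) n * p n * S)
          ≈⟨ solve 4 (λ a b c d → a :* (b :* c :* d) := a :* c :* (b :* d)) refl _ _ _ _ ⟩
        M 0 (suc L) * p n * (pochhammer (q * 1#) (q * 1#) n * S)
          ≈⟨ *-congˡ (finiteJacobi (suc L)) ⟨
        M 0 (suc L) * p n * (pochhammer q (q * 1#) (suc (suc L)) * pochhammer 1# (q * 1#) (suc L))
          ≈⟨ *-congˡ (trans (*-congˡ (pochhammer-1 (q * 1#) L)) (zeroʳ _)) ⟩
        M 0 (suc L) * p n * 0#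
          ≈⟨ zeroʳ _ ⟩
        0# ∎
        where
        n = suc (suc L ℕ.+ suc L)
        S = Σ≤ (suc L) (λ s → g q 1# s * h (suc L) s)

    -- `T δ₀ = p` is the factor `1/(q)_N` belonging to the innermost summation index.
    p-expands : Expands p (g q (q * 1#))
    p-expands = Expands-cong T-δ₀ (λ _ → refl) (T-expands δ₀-expands)
      where
      T-δ₀ : ∀ L → T δ₀ L ≈ p L
      T-δ₀ L = begin
        T δ₀ L                      ≈⟨ Σ-truncate {B} z≤n vanish ⟩
        p L * (1# * 1#)             ≈⟨ solve 1 (λ a → a :* (:1 :* :1) := a) refl _ ⟩
        p L                         ∎
        where
        vanish : ∀ y → 0 < y → pm L y * (V 0 y * δ₀ y) ≈ 0#
        vanish (suc y) _ = trans (*-congˡ (zeroʳ _)) (zeroʳ _)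

    -- F d i m x is p x times the sum over N_{i+1}, ..., N_{i+m} with N_i = x.
    F : ℕ → ℕ → ℕ → ℕ → Carrier
    F d i zero    x = p x
    F d i (suc m) x = p x * pochhammer q q (x ℕ.+ δ d i) * T (F d (suc i) m) (x ℕ.+ δ d i)

    -- Where the delta is zero, the prefactor `p x` times `(q)_x` is `1` and a level is a bare `T`.
    F-expands-plain : ∀ d i m → (∀ j → i ≤ j → j < i ℕ.+ m → δ d j ≡ 0) →
      Expands (F d i m) (g q (q ^ suc m))
    F-expands-plain d i zero    δ≡0 = p-expands
    F-expands-plain d i (suc m) δ≡0 = Expands-cong unshift (λ _ → refl) (T-expands (F-expands-plain d (suc i) m
        (λ j i<j j<i+m → δ≡0 j (ℕₚ.<⇒≤ i<j) (≡.subst (j <_) (≡.sym (ℕₚ.+-suc i m)) j<i+m))))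
      where
      unshift : ∀ x → T (F d (suc i) m) x ≈ F d i (suc m) x
      unshift x rewrite δ≡0 i ℕₚ.≤-refl (≡.subst (i <_) (≡.sym (ℕₚ.+-suc i m)) (s≤s (ℕₚ.m≤m+n i m))) | ℕₚ.+-identityʳ x =
        trans (sym (*-identityˡ _)) (*-congʳ (trans (sym (p-inverse x)) (*-comm _ _)))

    δ-refl : ∀ d → δ d d ≡ 1
    δ-refl zero    = ≡.refl
    δ-refl (suc d) = δ-refl d

    δ-< : ∀ {i j} → i < j → δ j i ≡ 0
    δ-< {zero}  (s≤s _)       = ≡.refl
    δ-< {suc i} (s≤s i<j) = δ-< i<j

    δ-> : ∀ {i j} → i < j → δ i j ≡ 0
    δ-> {zero}  (s≤s _)   = ≡.refl
    δ-> {suc i} (s≤s i<j) = δ-> i<j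

    -- The delta has `t` levels outside it and `e` inside. At its level `p x` times `(q)_{x+1}` is
    -- `1 - q^{x+1}`, so `S` acts after `e + 2` applications of `T`; it exchanges the arguments, and
    -- the outer `T` raise the other one.
    F-expands-shifted : ∀ i t e → Expands (F (i ℕ.+ t) i (t ℕ.+ suc e)) (g (q ^ suc (suc e)) (q ^ suc t))
    F-expands-shifted i zero e rewrite ℕₚ.+-identityʳ i = Expands-cong shift
        (g-cong refl (sym (*-identityʳ q)))
        (shift-expands (T-expands (F-expands-plain i (suc i) e (λ j i<j _ → δ-> i<j))))
      where
      shift : ∀ x → (1# - q ^ suc x) * T (F i (suc i) e) (suc x) ≈ F i i (suc e) x
      shift x rewrite δ-refl i | ℕₚ.+-comm x 1 = *-congʳ (begin
        1# - q ^ suc x                                    ≈⟨ *-identityˡ _ ⟨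
        1# * (1# - q ^ suc x)                             ≈⟨ *-congʳ (p-inverse x) ⟨
        pochhammer q q x * p x * (1# - q ^ suc x)         ≈⟨ solve 3 (λ a b c → a :* b :* c := b :* (a :* c)) refl _ _ _ ⟩
        p x * pochhammer q q (suc x)                      ∎)
    F-expands-shifted i (suc t) e = Expands-cong unshift (λ _ → refl) (T-expands (F-expands-shifted (suc i) t e))
      where
      unshift : ∀ x → T (F (suc i ℕ.+ t) (suc i) (t ℕ.+ suc e)) x ≈ F (i ℕ.+ suc t) i (suc t ℕ.+ suc e) x
      unshift x rewrite ℕₚ.+-suc i t | δ-< {i} {suc (i ℕ.+ t)} (s≤s (ℕₚ.m≤m+n i t)) | ℕₚ.+-identityʳ x =
        trans (sym (*-identityˡ _)) (*-congʳ (trans (sym (p-inverse x)) (*-comm _ _)))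

    M-stable : ∀ j → M 0 (j ℕ.+ ν) ≈ M 0 ν
    M-stable zero    = refl
    M-stable (suc j) = trans (*-congˡ (+-congˡ (^-vanish (s≤s (ℕₚ.m≤n+m ν j)))))
      (trans (*-congˡ (+-identityʳ 1#)) (trans (*-identityʳ _) (M-stable j)))

    -- The outermost sum is `(q)_ν` times `T f` at `L = B + ν`, where `pm L z` has reached `p ν` for
    -- every `z ≤ B`. It thus acts as one more `T`, evaluated at infinity.
    Σ-limit : ∀ {f x y} → Expands f (g x y) →
      Σ≤ B (λ z → V 0 z * f z) ≈ M 0 ν * p ν * Σ≤ ν (g x (q * y))
    Σ-limit {f} {x} {y} ex = begin
      S
        ≈⟨ trans (sym (*-identityˡ S)) (*-congʳ (sym (p-inverse ν))) ⟩
      pochhammer q q ν * p ν * S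
        ≈⟨ trans (*-assoc _ _ _) (*-congˡ (sym (Σ-distribˡ-* B _ _))) ⟩
      pochhammer q q ν * Σ≤ B (λ z → p ν * (V 0 z * f z))
        ≈⟨ *-congˡ (Σ-cong≤ B (λ z z≤B → *-congʳ (pm-stable (ℕₚ.+-monoˡ-≤ ν z≤B)))) ⟨
      pochhammer q q ν * T f L
        ≈⟨ *-congˡ (T-expands ex L L ℕₚ.≤-refl) ⟩
      pochhammer q q ν * Σ≤ L (λ s → g x (q * y) s * (M 0 L * h L s))
        ≈⟨ *-congˡ (trans (Σ-cong L (λ s → solve 3 (λ a b c → a :* (b :* c) := b :* (a :* c)) refl _ _ _)) (Σ-distribˡ-* L _ _)) ⟩
      pochhammer q q ν * (M 0 L * Σ≤ L (λ s → g x (q * y) s * h L s))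
        ≈⟨ *-congˡ (*-cong (M-stable B) (Σ-h-limit (ℕₚ.+-monoˡ-≤ ν (ℕₚ.<⇒≤ ν<B)) (g-vanish x y))) ⟩
      pochhammer q q ν * (M 0 ν * (p ν * p ν * Σ≤ ν (g x (q * y))))
        ≈⟨ solve 4 (λ F M p s → F :* (M :* (p :* p :* s)) := F :* p :* (M :* p :* s)) refl _ _ _ _ ⟩
      pochhammer q q ν * p ν * (M 0 ν * p ν * Σ≤ ν (g x (q * y)))
        ≈⟨ trans (*-congʳ (p-inverse ν)) (*-identityˡ _) ⟩
      M 0 ν * p ν * Σ≤ ν (g x (q * y)) ∎
      where
      L = B ℕ.+ ν
      S = Σ≤ B (λ z → V 0 z * f z)

    -- `M 0 n` times `(q;q)_n` is `(q^2;q^2)_n`, the even factors of `(q;q)_{2n}`; `(q;q^2)_n` gives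
    -- the odd ones.
    euler-finite : ∀ n → pochhammer q (q * q) n * M 0 n * pochhammer q q n ≈ pochhammer q q (n ℕ.+ n)
    euler-finite zero    = solve 0 (:1 :* :1 :* :1 := :1) refl
    euler-finite (suc n) = begin
      pochhammer q (q * q) n * (1# - q * (q * q) ^ n) * (M 0 n * (1# + q * q ^ n)) * (pochhammer q q n * (1# - q * q ^ n))
        ≈⟨ *-congʳ (*-congʳ (*-congˡ (+-congˡ (-‿cong (*-congˡ (^-distrib-* q q n)))))) ⟩
      pochhammer q (q * q) n * (1# - q * (q ^ n * q ^ n)) * (M 0 n * (1# + q * q ^ n)) * (pochhammer q q n * (1# - q * q ^ n))
        ≈⟨ solve 5 (λ a b c q Y → a :* (:1 :- q :* (Y :* Y)) :* (b :* (:1 :+ q :* Y)) :* (c :* (:1 :- q :* Y)) :=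
              a :* b :* c :* (:1 :- q :* (Y :* Y)) :* (:1 :- q :* (q :* (Y :* Y)))) refl _ _ _ q (q ^ n) ⟩
      pochhammer q (q * q) n * M 0 n * pochhammer q q n * (1# - q * (q ^ n * q ^ n)) * (1# - q * (q * (q ^ n * q ^ n)))
        ≈⟨ *-cong (*-cong (euler-finite n) (+-congˡ (-‿cong (*-congˡ (sym (^-homo-* q n n))))))
                  (+-congˡ (-‿cong (*-congˡ (*-congˡ (sym (^-homo-* q n n)))))) ⟩
      pochhammer q q (suc (suc (n ℕ.+ n)))
        ≡⟨ ≡.cong (pochhammer q q ∘ suc) (ℕₚ.+-suc n n) ⟨
      pochhammer q q (suc n ℕ.+ suc n) ∎

    euler : ∀ n → ν < n → pochhammer q (q * q) n * M 0 ν ≈ 1#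
    euler n ν<n = begin
      pochhammer q (q * q) n * M 0 ν
        ≈⟨ *-congˡ (trans (sym (M-stable (n ∸ ν))) (reflexive (≡.cong (M 0) (ℕₚ.m∸n+n≡m (ℕₚ.<⇒≤ ν<n))))) ⟩
      pochhammer q (q * q) n * M 0 n
        ≈⟨ trans (sym (*-identityʳ _)) (*-congˡ (sym (p-inverse n))) ⟩
      pochhammer q (q * q) n * M 0 n * (pochhammer q q n * p n)
        ≈⟨ trans (sym (*-assoc _ _ _)) (*-congʳ (euler-finite n)) ⟩
      pochhammer q q (n ℕ.+ n) * p n
        ≈⟨ *-congʳ (trans (pochhammer-stable q (ℕₚ.≤-trans ν<n (ℕₚ.m≤m+n n n))) (sym (pochhammer-stable q ν<n))) ⟩
      pochhammer q q n * p n
        ≈⟨ p-inverse n ⟩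
      1# ∎

  -- Transfer of the concrete products and multisums to the ring.

  -- An arbitrary homomorphism in place of the truncation keeps the coefficient sums opaque to unification.
  module Image (⟦_⟧ : PS → Carrier)
    (homo : RingMorphisms.IsRingHomomorphism rawPS rawRing ⟦_⟧)
    (ν : ℕ) (mono-ν : ⟦ mono (suc ν) ⟧ ≈ 0#) where
    open RingMorphisms.IsRingHomomorphism homo using (+-homo; *-homo; -‿homo; 0#-homo; 1#-homo; ⟦⟧-cong)

    q : Carrier
    q = ⟦ mono 1 ⟧

    mono-^ : ∀ e → ⟦ mono e ⟧ ≈ q ^ e
    mono-^ zero    = 1#-homo
    mono-^ (suc e) = trans (⟦⟧-cong (mono-suc e)) (trans (*-homo _ _) (*-congˡ (mono-^ e)))

    mono-+ : ∀ d e → ⟦ mono (d ℕ.+ e) ⟧ ≈ ⟦ mono d ⟧ * ⟦ mono e ⟧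
    mono-+ d e = trans (mono-^ (d ℕ.+ e)) (trans (^-homo-* q d e) (*-cong (sym (mono-^ d)) (sym (mono-^ e))))

    q^≈0 : q ^ suc ν ≈ 0#
    q^≈0 = trans (sym (mono-^ (suc ν))) mono-ν

    open Nilpotent q ν q^≈0 using (^-vanish)

    poch-pochhammer : ∀ a k L → ⟦ poch a k L ⟧ ≈ pochhammer (q ^ a) (q ^ k) L
    poch-pochhammer a k zero    = 1#-homo
    poch-pochhammer a k (suc L) = trans (*-homo _ _) (*-cong (poch-pochhammer a k L)
      (trans (+-homo _ _) (+-cong 1#-homo (trans (-‿homo _) (-‿cong (begin
        ⟦ mono (a ℕ.+ k ℕ.* L) ⟧   ≈⟨ mono-^ (a ℕ.+ k ℕ.* L) ⟩
        q ^ (a ℕ.+ k ℕ.* L)        ≈⟨ ^-homo-* q a (k ℕ.* L) ⟩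
        q ^ a * q ^ (k ℕ.* L)      ≈⟨ *-congˡ (^-assocʳ q k L) ⟨
        q ^ a * (q ^ k) ^ L        ∎))))))

    poch-inverse : ∀ a k L → ⟦ poch (suc a) k L ⟧ * ⟦ inv (poch (suc a) k L) ⟧ ≈ 1#
    poch-inverse a k L = trans (sym (*-homo _ _))
      (trans (⟦⟧-cong (inv-inverseʳ (poch (suc a) k L) (poch-constant a k L))) 1#-homo)

    qfac-pochhammer : ∀ N → ⟦ qfac N ⟧ ≈ pochhammer q q N
    qfac-pochhammer N = trans (poch-pochhammer 1 1 N) (pochhammer-cong (*-identityʳ q) (*-identityʳ q) N)

    p : ℕ → Carrier
    p N = ⟦ inv (qfac N) ⟧

    p-inverse : ∀ N → pochhammer q q N * p N ≈ 1#
    p-inverse N = trans (*-congʳ (sym (qfac-pochhammer N))) (poch-inverse 0 1 N)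

    open Reciprocals q p p-inverse
    open BaileyChain q p p-inverse using (V; M; Expands)

    mono-triangle : ∀ y → ⟦ mono (suc y C 2) ⟧ ≈ V 0 y
    mono-triangle zero    = 1#-homo
    mono-triangle (suc y) = begin
      ⟦ mono (suc (suc y) C 2) ⟧                ≡⟨ ≡.cong (λ e → ⟦ mono e ⟧) (triangle-suc y) ⟩
      ⟦ mono (suc y ℕ.+ (suc y C 2)) ⟧          ≈⟨ mono-+ (suc y) (suc y C 2) ⟩
      ⟦ mono (suc y) ⟧ * ⟦ mono (suc y C 2) ⟧   ≈⟨ *-cong (mono-^ (suc y)) (mono-triangle y) ⟩
      q ^ suc y * V 0 y                         ≈⟨ *-comm _ _ ⟩
      V 0 y * q ^ suc y                         ∎

    gauss-pm : ∀ N K → ⟦ gauss N K ⟧ ≈ pochhammer q q N * p K * pm N K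
    gauss-pm N K with K ≤ᵇ N in eq
    ... | true  = trans (*-homo _ _) (*-cong (trans (*-homo _ _) (*-congʳ (qfac-pochhammer N)))
                    (reflexive (≡.sym (pm-∸ (ℕₚ.≤ᵇ⇒≤ K N (≡.subst Bool.T (≡.sym eq) tt))))))
    ... | false = trans 0#-homo (sym (trans (*-congˡ (pm-zero {N} {K} (ℕₚ.≰⇒> (λ K≤N → ≡.subst Bool.T eq (ℕₚ.≤⇒≤ᵇ K≤N))))) (zeroʳ _)))

    sumPS-++ : ∀ xs ys → ⟦ sumPS (xs ++ ys) ⟧ ≈ ⟦ sumPS xs ⟧ + ⟦ sumPS ys ⟧
    sumPS-++ []       ys = sym (trans (+-congʳ 0#-homo) (+-identityˡ _))
    sumPS-++ (x ∷ xs) ys = begin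
      ⟦ x ⊕ sumPS (xs ++ ys) ⟧                     ≈⟨ +-homo _ _ ⟩
      ⟦ x ⟧ + ⟦ sumPS (xs ++ ys) ⟧                 ≈⟨ +-congˡ (sumPS-++ xs ys) ⟩
      ⟦ x ⟧ + (⟦ sumPS xs ⟧ + ⟦ sumPS ys ⟧)        ≈⟨ +-assoc _ _ _ ⟨
      ⟦ x ⟧ + ⟦ sumPS xs ⟧ + ⟦ sumPS ys ⟧          ≈⟨ +-congʳ (+-homo _ _) ⟨
      ⟦ x ⊕ sumPS xs ⟧ + ⟦ sumPS ys ⟧              ∎

    module _ {A : Set} where
      sumPS-scale : ∀ a {φ ψ : A → PS} → (∀ w → ⟦ φ w ⟧ ≈ a * ⟦ ψ w ⟧) →
        ∀ ws → ⟦ sumPS (map φ ws) ⟧ ≈ a * ⟦ sumPS (map ψ ws) ⟧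
      sumPS-scale a φ≈aψ []       = trans 0#-homo (sym (trans (*-congˡ 0#-homo) (zeroʳ a)))
      sumPS-scale a {φ} {ψ} φ≈aψ (w ∷ ws) = begin
        ⟦ φ w ⊕ sumPS (map φ ws) ⟧                     ≈⟨ +-homo _ _ ⟩
        ⟦ φ w ⟧ + ⟦ sumPS (map φ ws) ⟧                 ≈⟨ +-cong (φ≈aψ w) (sumPS-scale a φ≈aψ ws) ⟩
        a * ⟦ ψ w ⟧ + a * ⟦ sumPS (map ψ ws) ⟧         ≈⟨ distribˡ a _ _ ⟨
        a * (⟦ ψ w ⟧ + ⟦ sumPS (map ψ ws) ⟧)           ≈⟨ *-congˡ (+-homo _ _) ⟨
        a * ⟦ ψ w ⊕ sumPS (map ψ ws) ⟧                 ∎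

      sumPS-concatMap : ∀ (φ : A → PS) (ws : ℕ → List A) f B →
        ⟦ sumPS (map φ (concatMap ws (applyUpTo f (suc B)))) ⟧ ≈ Σ≤ B (λ x → ⟦ sumPS (map φ (ws (f x))) ⟧)
      sumPS-concatMap φ ws f zero = reflexive (≡.cong (λ l → ⟦ sumPS (map φ l) ⟧) (++-identityʳ (ws (f 0))))
      sumPS-concatMap φ ws f (suc B) = begin
        ⟦ sumPS (map φ (ws (f 0) ++ rest)) ⟧
          ≡⟨ ≡.cong (λ l → ⟦ sumPS l ⟧) (map-++ φ (ws (f 0)) rest) ⟩
        ⟦ sumPS (map φ (ws (f 0)) ++ map φ rest) ⟧
          ≈⟨ sumPS-++ (map φ (ws (f 0))) (map φ rest) ⟩
        ⟦ sumPS (map φ (ws (f 0))) ⟧ + ⟦ sumPS (map φ rest) ⟧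
          ≈⟨ +-congˡ (sumPS-concatMap φ ws (f ∘ suc) B) ⟩
        ⟦ sumPS (map φ (ws (f 0))) ⟧ + Σ≤ B (λ x → ⟦ sumPS (map φ (ws (f (suc x)))) ⟧)
          ≈⟨ Σ-head B _ ⟨
        Σ≤ (suc B) (λ x → ⟦ sumPS (map φ (ws (f x))) ⟧) ∎
        where rest = concatMap ws (applyUpTo (f ∘ suc) (suc B))

    sumPS-box : ∀ B m (φ : Vec ℕ (suc m) → PS) →
      ⟦ sumPS (map φ (box B (suc m))) ⟧ ≈ Σ≤ B (λ x → ⟦ sumPS (map (φ ∘ (x ∷_)) (box B m)) ⟧)
    sumPS-box B m φ = trans (sumPS-concatMap φ (λ x → map (x ∷_) (box B m)) (λ x → x) B)
      (Σ-cong B (λ x → reflexive (≡.cong (λ l → ⟦ sumPS l ⟧) (≡.sym (map-∘ (box B m))))))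

    theta-product : ∀ k l B → ν < B →
      ⟦ poch (suc k) (suc k ℕ.+ suc l) B ⟧ * ⟦ poch (suc l) (suc k ℕ.+ suc l) B ⟧ * ⟦ poch (suc k ℕ.+ suc l) (suc k ℕ.+ suc l) B ⟧
        ≈ Σ≤ ν (g (q ^ suc k) (q ^ suc l))
    theta-product k l B ν<B = trans
      (*-cong (*-cong (to-Q (suc k)) (to-Q (suc l))) (trans (poch-pochhammer m m B) (pochhammer-cong q^m q^m B)))
      (jacobi B ν<B)
      where
      m = suc k ℕ.+ suc l
      x = q ^ suc k
      y = q ^ suc l
      q^m : q ^ m ≈ x * y
      q^m = ^-homo-* q (suc k) (suc l)
      to-Q : ∀ a → ⟦ poch a m B ⟧ ≈ pochhammer (q ^ a) (x * y) B
      to-Q a = trans (poch-pochhammer a m B) (pochhammer-cong refl q^m B)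
      inverse : ∀ N → pochhammer (x * y) (x * y) N * ⟦ inv (poch m m N) ⟧ ≈ 1#
      inverse N = trans (*-congʳ (sym (trans (poch-pochhammer m m N) (pochhammer-cong q^m q^m N)))) (poch-inverse (k ℕ.+ suc l) m N)
      nilpotent : (x * y) ^ suc ν ≈ 0#
      nilpotent = begin
        (x * y) ^ suc ν      ≈⟨ ^-congˡ (suc ν) q^m ⟨
        (q ^ m) ^ suc ν      ≈⟨ ^-assocʳ q m (suc ν) ⟩
        q ^ (m ℕ.* suc ν)    ≈⟨ ^-vanish (ℕₚ.m≤m+n (suc ν) _) ⟩
        0#                   ∎
      open Chain q p p-inverse ν q^≈0 B ν<B using (g-vanish)
      -- `q ^ suc l` unfolds to `q * q ^ l`, the shape in which `g-vanish` applies.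
      open TripleProductLimit x y (λ N → ⟦ inv (poch m m N) ⟧) inverse ν nilpotent (g-vanish x (q ^ l))

    -- Read off from the product side, where the exchange is commutativity; on the series `n ↦ -n`
    -- does not respect the pairs `-s`, `s+1`.
    theta-symmetric : ∀ k l → Σ≤ ν (g (q ^ suc k) (q ^ suc l)) ≈ Σ≤ ν (g (q ^ suc l) (q ^ suc k))
    theta-symmetric k l = begin
      Σ≤ ν (g (q ^ suc k) (q ^ suc l))
        ≈⟨ theta-product k l B ℕₚ.≤-refl ⟨
      ⟦ poch (suc k) m B ⟧ * ⟦ poch (suc l) m B ⟧ * ⟦ poch m m B ⟧
        ≈⟨ *-congʳ (*-comm _ _) ⟩
      ⟦ poch (suc l) m B ⟧ * ⟦ poch (suc k) m B ⟧ * ⟦ poch m m B ⟧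
        ≡⟨ ≡.cong (λ m → ⟦ poch (suc l) m B ⟧ * ⟦ poch (suc k) m B ⟧ * ⟦ poch m m B ⟧) (ℕₚ.+-comm (suc k) (suc l)) ⟩
      ⟦ poch (suc l) (suc l ℕ.+ suc k) B ⟧ * ⟦ poch (suc k) (suc l ℕ.+ suc k) B ⟧ * ⟦ poch (suc l ℕ.+ suc k) (suc l ℕ.+ suc k) B ⟧
        ≈⟨ theta-product l k B ℕₚ.≤-refl ⟩
      Σ≤ ν (g (q ^ suc l) (q ^ suc k)) ∎
      where
      B = suc ν
      m = suc k ℕ.+ suc l

    lhs-theta : ∀ {m a} → a ≤ m → ∀ B → ν < B →
      ⟦ lhsTrunc m a B ⟧ ≈ M 0 ν * p ν * Σ≤ ν (g (q ^ suc a) (q ^ suc (m ∸ a)))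
    lhs-theta {m} {a} a≤m B ν<B = begin
      ⟦ lhsTrunc m a B ⟧
        ≈⟨ trans (*-homo _ _) (*-congʳ (trans (*-homo _ _) (*-congʳ (trans (*-homo _ _) (*-congʳ (*-homo _ _)))))) ⟩
      ⟦ poch (suc a) (m ℕ.+ 2) B ⟧ * ⟦ poch (suc m ∸ a) (m ℕ.+ 2) B ⟧ * ⟦ poch (m ℕ.+ 2) (m ℕ.+ 2) B ⟧ * p B * ⟦ inv (poch 1 2 B) ⟧
        ≡⟨ ≡.cong₂ (λ l M → ⟦ poch (suc a) M B ⟧ * ⟦ poch l M B ⟧ * ⟦ poch M M B ⟧ * p B * ⟦ inv (poch 1 2 B) ⟧) (ℕₚ.+-∸-assoc 1 a≤m) modulus ⟩
      ⟦ poch (suc a) (suc a ℕ.+ suc d) B ⟧ * ⟦ poch (suc d) (suc a ℕ.+ suc d) B ⟧ * ⟦ poch (suc a ℕ.+ suc d) (suc a ℕ.+ suc d) B ⟧ * p B * ⟦ inv (poch 1 2 B) ⟧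
        ≈⟨ *-cong (*-cong (theta-product a d B ν<B) (p-stable (ℕₚ.<⇒≤ ν<B))) inv-euler ⟩
      Σ≤ ν (g (q ^ suc a) (q ^ suc d)) * p ν * M 0 ν
        ≈⟨ solve 3 (λ s p m → s :* p :* m := m :* p :* s) refl _ _ _ ⟩
      M 0 ν * p ν * Σ≤ ν (g (q ^ suc a) (q ^ suc d)) ∎
      where
      d = m ∸ a
      open Chain q p p-inverse ν q^≈0 B ν<B using (euler)
      open Nilpotent.Limits q ν q^≈0 p p-inverse using (p-stable)
      modulus : m ℕ.+ 2 ≡ suc a ℕ.+ suc d
      modulus = ≡.trans (ℕₚ.+-comm m 2) (≡.trans (≡.cong (suc ∘ suc) (≡.sym (ℕₚ.m+[n∸m]≡n a≤m))) (≡.cong suc (≡.sym (ℕₚ.+-suc a d))))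
      q² : q ^ 2 ≈ q * q
      q² = *-congˡ (*-identityʳ q)
      inv-euler : ⟦ inv (poch 1 2 B) ⟧ ≈ M 0 ν
      inv-euler = begin
        ⟦ inv (poch 1 2 B) ⟧                                            ≈⟨ *-identityʳ _ ⟨
        ⟦ inv (poch 1 2 B) ⟧ * 1#                                       ≈⟨ *-congˡ (euler B ν<B) ⟨
        ⟦ inv (poch 1 2 B) ⟧ * (pochhammer q (q * q) B * M 0 ν)         ≈⟨ *-congˡ (*-congʳ (trans (poch-pochhammer 1 2 B) (pochhammer-cong (*-identityʳ q) q² B))) ⟨
        ⟦ inv (poch 1 2 B) ⟧ * (⟦ poch 1 2 B ⟧ * M 0 ν)                     ≈⟨ solve 3 (λ a b c → a :* (b :* c) := b :* a :* c) refl _ _ _ ⟩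
        ⟦ poch 1 2 B ⟧ * ⟦ inv (poch 1 2 B) ⟧ * M 0 ν                       ≈⟨ *-congʳ (poch-inverse 0 2 B) ⟩
        1# * M 0 ν                                                  ≈⟨ *-identityˡ _ ⟩
        M 0 ν                                                       ∎

    module _ (B : ℕ) (ν<B : ν < B) where
      open Chain q p p-inverse ν q^≈0 B ν<B

      chainSum : ℕ → ℕ → ℕ → ℕ → Carrier
      chainSum d i m x = ⟦ sumPS (map (λ w → mono (triSum (toList w)) ⊗ gaussChain d i (x ∷ toList w)) (box B m)) ⟧

      mono-triSum : ∀ y {m} (w : Vec ℕ m) → ⟦ mono (triSum (y ∷ toList w)) ⟧ ≈ V 0 y * ⟦ mono (triSum (toList w)) ⟧
      mono-triSum y w = trans (mono-+ (suc y C 2) (triSum (toList w))) (*-congʳ (mono-triangle y))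

      chainSum-suc : ∀ d i m x → chainSum d i (suc m) x ≈
        Σ≤ B (λ y → V 0 y * ⟦ gauss (x ℕ.+ δ d i) y ⟧ * chainSum d (suc i) m y)
      chainSum-suc d i m x = trans (sumPS-box B m _) (Σ-cong B (λ y → sumPS-scale _ (λ w → begin
        ⟦ mono (triSum (y ∷ toList w)) ⊗ (gauss (x ℕ.+ δ d i) y ⊗ gaussChain d (suc i) (y ∷ toList w)) ⟧
          ≈⟨ trans (*-homo _ _) (*-cong (mono-triSum y w) (*-homo _ _)) ⟩
        V 0 y * ⟦ mono (triSum (toList w)) ⟧ * (⟦ gauss (x ℕ.+ δ d i) y ⟧ * ⟦ gaussChain d (suc i) (y ∷ toList w) ⟧)
          ≈⟨ solve 4 (λ a b c d → a :* b :* (c :* d) := a :* c :* (b :* d)) refl _ _ _ _ ⟩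
        V 0 y * ⟦ gauss (x ℕ.+ δ d i) y ⟧ * (⟦ mono (triSum (toList w)) ⟧ * ⟦ gaussChain d (suc i) (y ∷ toList w) ⟧)
          ≈⟨ *-congˡ (*-homo _ _) ⟨
        V 0 y * ⟦ gauss (x ℕ.+ δ d i) y ⟧ * ⟦ mono (triSum (toList w)) ⊗ gaussChain d (suc i) (y ∷ toList w) ⟧ ∎) (box B m)))

      -- A Gaussian coefficient is `(q)_z` times `p y` times `pm z y`. Its `p y` is handed to the
      -- next level, hence the `p x` carried by `F`; at the top that factor is the `1/(q)_{N_1}` of
      -- the summand.
      chainSum-F : ∀ d i m x → p x * chainSum d i m x ≈ F d i m x
      chainSum-F d i zero    x = begin
        p x * ⟦ onePS ⊗ onePS ⊕ zeroPS ⟧      ≈⟨ *-congˡ (trans (+-homo _ _) (+-cong (trans (*-homo _ _) (*-cong 1#-homo 1#-homo)) 0#-homo)) ⟩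
        p x * (1# * 1# + 0#)                  ≈⟨ solve 1 (λ a → a :* (:1 :* :1 :+ :0) := a) refl (p x) ⟩
        p x                                   ∎
      chainSum-F d i (suc m) x = begin
        p x * chainSum d i (suc m) x
          ≈⟨ *-congˡ (chainSum-suc d i m x) ⟩
        p x * Σ≤ B (λ y → V 0 y * ⟦ gauss z y ⟧ * chainSum d (suc i) m y)
          ≈⟨ *-congˡ (Σ-cong B (λ y → begin
               V 0 y * ⟦ gauss z y ⟧ * chainSum d (suc i) m y
                 ≈⟨ *-congʳ (*-congˡ (gauss-pm z y)) ⟩
               V 0 y * (pochhammer q q z * p y * pm z y) * chainSum d (suc i) m y
                 ≈⟨ solve 5 (λ V Q p r c → V :* (Q :* p :* r) :* c := Q :* (r :* (V :* (p :* c)))) refl _ _ _ _ _ ⟩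
               pochhammer q q z * (pm z y * (V 0 y * (p y * chainSum d (suc i) m y)))
                 ≈⟨ *-congˡ (*-congˡ (*-congˡ (chainSum-F d (suc i) m y))) ⟩
               pochhammer q q z * (pm z y * (V 0 y * F d (suc i) m y)) ∎)) ⟩
        p x * Σ≤ B (λ y → pochhammer q q z * (pm z y * (V 0 y * F d (suc i) m y)))
          ≈⟨ trans (*-congˡ (Σ-distribˡ-* B _ _)) (sym (*-assoc _ _ _)) ⟩
        F d i (suc m) x ∎
        where z = x ℕ.+ δ d i

      rhs-F : ∀ m a → ⟦ rhsTrunc (suc m) a B ⟧ ≈ Σ≤ B (λ x → V 0 x * F (suc m ∸ a) 1 m x)
      rhs-F m a = trans (sumPS-box B m _) (Σ-cong B (λ x → trans (sumPS-scale (V 0 x * p x) (λ w → begin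
        ⟦ mono (triSum (x ∷ toList w)) ⊗ inv (qfac x) ⊗ gaussChain d 1 (x ∷ toList w) ⟧
          ≈⟨ trans (*-homo _ _) (*-congʳ (trans (*-homo _ _) (*-congʳ (mono-triSum x w)))) ⟩
        V 0 x * ⟦ mono (triSum (toList w)) ⟧ * p x * ⟦ gaussChain d 1 (x ∷ toList w) ⟧
          ≈⟨ solve 4 (λ a b c d → a :* b :* c :* d := a :* c :* (b :* d)) refl _ _ _ _ ⟩
        V 0 x * p x * (⟦ mono (triSum (toList w)) ⟧ * ⟦ gaussChain d 1 (x ∷ toList w) ⟧)
          ≈⟨ *-congˡ (*-homo _ _) ⟨
        V 0 x * p x * ⟦ mono (triSum (toList w)) ⊗ gaussChain d 1 (x ∷ toList w) ⟧ ∎) (box B m))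
        (trans (*-assoc _ _ _) (*-congˡ (chainSum-F d 1 m x)))))
        where d = suc m ∸ a

      rhs-theta : ∀ m a → a ≤ suc m →
        ⟦ rhsTrunc (suc m) a B ⟧ ≈ M 0 ν * p ν * Σ≤ ν (g (q ^ suc a) (q ^ suc (suc m ∸ a)))
      rhs-theta m a a≤m = trans (rhs-F m a) (cases a a≤m)
        where
        q¹ : q ≈ q ^ 1
        q¹ = sym (*-identityʳ q)
        cases : ∀ a → a ≤ suc m → Σ≤ B (λ x → V 0 x * F (suc m ∸ a) 1 m x) ≈
          M 0 ν * p ν * Σ≤ ν (g (q ^ suc a) (q ^ suc (suc m ∸ a)))
        -- The delta index `suc m` lies beyond the last Gaussian coefficient.
        cases zero _ = trans
          (Σ-limit (F-expands-plain (suc m) 1 m (λ j _ j≤m → δ-< j≤m)))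
          (*-congˡ (Σ-cong ν (g-cong q¹ refl)))
        cases (suc e) (s≤s e≤m) with ℕₚ.m≤n⇒m<n∨m≡n e≤m
        -- The delta index is `0`, before the first Gaussian coefficient. `Σ-limit` yields the
        -- arguments `q` and `q ^ (m + 2)`, in the order opposite to the goal.
        ... | inj₂ ≡.refl rewrite ℕₚ.n∸n≡0 m = trans
          (Σ-limit (F-expands-plain 0 1 m (λ j 0<j _ → δ-> 0<j)))
          (*-congˡ (trans (Σ-cong ν (g-cong q¹ refl)) (theta-symmetric 0 (suc m))))
        ... | inj₁ e<m = ≡.subst (λ d → Σ≤ B (λ x → V 0 x * F d 1 m x) ≈ M 0 ν * p ν * Σ≤ ν (g (q ^ suc (suc e)) (q ^ suc d)))
          1+t≡m∸e
          (Σ-limit (≡.subst (λ m → Expands (F (suc t) 1 m) (g (q ^ suc (suc e)) (q ^ suc t))) t+1+e≡m (F-expands-shifted 1 t e)))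
          where
          -- The delta index `m ∸ e` is `suc t`: of the `m` levels, `t` lie outside the delta and
          -- `e` inside.
          t = m ∸ suc e
          t+1+e≡m : t ℕ.+ suc e ≡ m
          t+1+e≡m = ℕₚ.m∸n+n≡m e<m
          1+t≡m∸e : suc t ≡ m ∸ e
          1+t≡m∸e = ≡.sym (ℕₚ.+-∸-assoc 1 e<m)

theorem5p2 : (m a : ℕ) → 1 ≤ m → a ≤ m →
    (n : ℕ) → ∃[ B ] ((B₁ B₂ : ℕ) → B ≤ B₁ → B ≤ B₂ →
    lhsTrunc m a B₁ n ≡ rhsTrunc m a B₂ n)
-- Modulo `q^{n+1}` each side equals the same expression, free of its cut-off, once that cut-off
-- exceeds `n`; so `suc n` serves both and `B₁`, `B₂` may differ.
theorem5p2 (suc m) a _ a≤m n = suc n , λ B₁ B₂ n<B₁ n<B₂ →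
  ≡.trans (lhs-theta a≤m B₁ n<B₁ n ℕₚ.≤-refl) (≡.sym (rhs-theta B₂ n<B₂ m a a≤m n ℕₚ.≤-refl))
  where
  open QSeries (truncatedPS n)
  open Image id (truncation n) n (λ i i≤n → mono-vanish (s≤s i≤n))
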